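{- Let $G$ be a finite connected graph with embedding scheme $\Pi=(\pi,\lambda)$, and let $\mathcal{C}=\mathcal{C}_1\cup\mathcal{C}_2$ be as defined in the context (for an arbitrary choice of breadth-first-search trees $T_x$, $x\in V(G)$). Then: (a) if $G$ contains a $\Pi$-twosided cycle, then $\mathcal{C}$ contains a $\Pi$-twosided cycle of minimum length among all $\Pi$-twosided cycles of $G$; (b) every even cycle of $G$ whose length is minimum among all even cycles of $G$ belongs to $\mathcal{C}$; (c) if a shortest cycle of $G$ (i.e. a cycle of length equal to the girth of $G$) has odd length, then every odd cycle of $G$ whose length is minimum among all odd cycles of $G$ belongs to $\mathcal{C}_1$.
   Context: Graphs are finite and connected; cycles are identified with their edge sets and the length $|C|$ of a cycle is its number of edges. An embedding scheme of $G$ is $\Pi=(\pi,\lambda)$ where $\pi=\{\pi_v: v\in V(G)\}$ is a rotation system ($\pi_v$ a cyclic ordering of the edges incident with $v$) and $\lambda:E(G)\to\{ -1,+1\}$ is a signature. A cycle is $\Pi$-twosided if it contains an even number of edges $e$ with $\lambda(e)=-1$, and $\Pi$-onesided otherwise. For each vertex $x$, $T_x$ denotes a breadth-first-search spanning tree of $G$ rooted at $x$ (so the path in $T_x$ from $x$ to any vertex is a shortest path in $G$). A fundamental cycle of a spanning tree $T$ is the unique cycle in $T+e$ for an edge $e\notin E(T)$. $\mathcal{C}_1$ is the set of all fundamental cycles of the trees $T_x$, $x\in V(G)$; $\mathcal{C}_2$ is the set of all cycles $C$ of $G$ such that $C=C_a\oplus C_b$ for some $C_a,C_b\in\mathcal{C}_1$,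 where $A\oplus B=(A\setminus B)\cup(B\setminus A)$ for edge sets $A,B$; and $\mathcal{C}=\mathcal{C}_1\cup\mathcal{C}_2$. -}

module Defs where

open import Data.Fin.Base using (Fin)
open import Data.Fin.Subset using (Subset; _∈_; _∉_; _⊆_; _∪_; _∩_; _─_; ⋃; ⁅_⁆; ∣_∣)
open import Data.List.Base as List using (List; []; _∷_; _∷ʳ_)
open import Data.List.Relation.Unary.Unique.Propositional using (Unique)
open import Data.Nat.Base using (ℕ; _≤_)
open import Data.Nat.Divisibility.Core using () renaming (_∣_ to _divides_)
open import Data.Nat.GeneralisedArithmetic using (iterate)
open import Data.Product.Base using (Σ; ∃; ∃-syntax; _×_; _,_; proj₁; proj₂)
open import Data.Sign.Base as Sign using (Sign)
import Data.Sign.Properties as Sign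
open import Data.Sum.Base using (_⊎_)
open import Data.Vec.Base using (tabulate)
open import Function.Bundles using (_↔_; Inverse)
open import Relation.Binary.PropositionalEquality.Core using (_≡_; _≢_)
open import Relation.Nullary.Decidable.Core using (does)
open import Relation.Nullary.Negation.Core using (¬_)

Even Odd : ℕ → Set
Even k = 2 divides k
Odd  k = ¬ Even k

infixl 6 _⊕_

_⊕_ : ∀ {m} → Subset m → Subset m → Subset m
A ⊕ B = (A ─ B) ∪ (B ─ A)

IsMinimum : ∀ {m} → (Subset m → Set) → Subset m → Set
IsMinimum P C = P C × (∀ D → P D → ∣ C ∣ ≤ ∣ D ∣)

-- Vertex set Fin n, edge set Fin m.  The order of the two ends of an edge is
-- irrelevant, see Joins.  Loops and parallel edges are allowed; simple graphs
-- are the special case without them.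
record Graph (n m : ℕ) : Set where
  field
    ends : Fin m → Fin n × Fin n

module _ {n m : ℕ} (G : Graph n m) where
  open Graph G

  Joins : Fin m → Fin n → Fin n → Set
  Joins e u v = ends e ≡ (u , v) ⊎ ends e ≡ (v , u)

  data Walk : Fin n → Fin n → Set where
    []   : ∀ {v} → Walk v v
    step : ∀ {u v w} (e : Fin m) → Joins e u v → Walk v w → Walk u w

  edges : ∀ {u v} → Walk u v → List (Fin m)
  edges []           = []
  edges (step e _ p) = e ∷ edges p

  -- The vertices visited, without the final one.
  sources : ∀ {u v} → Walk u v → List (Fin n)
  sources []                   = []
  sources (step {u = u} _ _ p) = u ∷ sources p

  edgeSet : ∀ {u v} → Walk u v → Subset m
  edgeSet p = ⋃ (List.map ⁅_⁆ (edges p))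

  length : ∀ {u v} → Walk u v → ℕ
  length p = List.length (edges p)

  IsPath : ∀ {u v} → Walk u v → Set
  IsPath {v = v} p = Unique (sources p ∷ʳ v)

  IsShortestPath : ∀ {u v} → Walk u v → Set
  IsShortestPath {u} {v} p = IsPath p × (∀ (q : Walk u v) → IsPath q → length p ≤ length q)

  Connected : Set
  Connected = ∀ u v → Walk u v

  -- Distinctness of the edges excludes traversing one edge back and forth.
  IsCycle : Subset m → Set
  IsCycle C = ∃[ v ] Σ (Walk v v) λ w →
    edges w ≢ [] × Unique (sources w) × Unique (edges w) × edgeSet w ≡ C

  EvenCycle OddCycle : Subset m → Set
  EvenCycle C = IsCycle C × Even ∣ C ∣
  OddCycle  C = IsCycle C × Odd ∣ C ∣

  IsSpanningTree : Subset m → Set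
  IsSpanningTree T =
    (∀ u v → Σ (Walk u v) λ p → edgeSet p ⊆ T) ×
    (∀ C → IsCycle C → ¬ (C ⊆ T))

  IsBFSTree : Fin n → Subset m → Set
  IsBFSTree x T = IsSpanningTree T ×
    (∀ v (p : Walk x v) → IsPath p → edgeSet p ⊆ T → IsShortestPath p)

  IsFundamentalCycle : Subset m → Subset m → Set
  IsFundamentalCycle T C = ∃[ e ] (e ∉ T × IsCycle C × C ⊆ T ∪ ⁅ e ⁆)

  module _ (T : Fin n → Subset m) where

    𝒞₁ 𝒞₂ 𝒞 : Subset m → Set
    𝒞₁ C = ∃[ x ] IsFundamentalCycle (T x) C
    𝒞₂ C = IsCycle C × (∃[ A ] ∃[ B ] (𝒞₁ A × 𝒞₁ B × C ≡ A ⊕ B))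
    𝒞  C = 𝒞₁ C ⊎ 𝒞₂ C

  -- The edges incident with v; a loop at v occurs twice, once for each end.
  IncidentEdge : Fin n → Set
  IncidentEdge v = Σ (Fin m) λ e → proj₁ (ends e) ≡ v ⊎ proj₂ (ends e) ≡ v

  -- A cyclic ordering is given by its successor permutation, which has a
  -- single orbit.
  record EmbeddingScheme : Set where
    field
      rotation  : ∀ v → IncidentEdge v ↔ IncidentEdge v
      cyclic    : ∀ v (d d′ : IncidentEdge v) →
                  ∃[ k ] iterate (Inverse.to (rotation v)) d k ≡ d′
      signature : Fin m → Sign

    negativeEdges : Subset m
    negativeEdges = tabulate λ e → does (signature e Sign.≟ Sign.-)

  TwoSidedCycle : EmbeddingScheme → Subset m → Set
  TwoSidedCycle Π C = IsCycle C × Even ∣ C ∩ EmbeddingScheme.negativeEdges Π ∣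

{-# OPTIONS --safe #-}
module Submission where

-- Root a breadth-first-search tree T at any vertex of a shortest cycle C of the required kind, and
-- write Z e for the fundamental cycle of a chord e of C (an edge outside T).  Going around C, either
-- Z e = C for some chord e, or two consecutive chords e, f have fundamental cycles sharing an edge,
-- so that Z e ⊕ Z f is a cycle: otherwise, by induction on the position of the chord e, the apex of
-- Z e lies on the piece of C just before e; for the last chord it also lies on the piece after e,
-- which contains the root, and then Z e is contained in C and hence equal to C.  As distances
-- from the root are at most distances along C, neither Z e nor Z e ⊕ Z f is longer than C.  Hence if
-- some Z e is two-sided it is a shortest two-sided cycle; if all are one-sided, Z e ⊕ Z f is.
-- When sides are given by the parity of the length, minimality makes these estimates tight, and a
-- chord whose ends have different distances from the root has an even fundamental cycle; this leaves
-- at most two chords on C.  If C is odd and has the length of the girth, tightness leaves only the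
-- edge antipodal to the root.

open import Defs
open import Data.Bool.Base using (Bool; true; false; not; _xor_)
open import Data.Bool.Properties using (xor-same; xor-comm; xor-assoc; xor-identityʳ; not-distribˡ-xor; not-distribʳ-xor; not-involutive)
import Data.Bool.Properties as Bool
open import Data.Empty using (⊥-elim)
open import Data.Fin.Base using (Fin; zero; suc)
open import Data.Fin.Properties using (_≟_; any?; injective⇒≤)
open import Data.Fin.Subset using (Subset; _∈_; _∉_; _⊆_; _∪_; _∩_; ⁅_⁆; ∣_∣; ⊥; ⊤; Nonempty; Empty)
open import Data.Fin.Subset.Properties
open import Data.List.Base as List using (List; []; _∷_; _∷ʳ_)
import Data.List.Membership.DecPropositional as DecMembership
open import Data.List.Membership.Propositional using () renaming (_∈_ to _∈ₗ_; _∉_ to _∉ₗ_)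
open import Data.List.Membership.Propositional.Properties using (∈-++⁺ʳ; ∈-++⁺ˡ; ∈-lookup)
open import Data.List.Relation.Unary.All as All using (All; []; _∷_)
open import Data.List.Relation.Unary.All.Properties using (All¬⇒¬Any; ¬Any⇒All¬)
open import Data.List.Relation.Unary.AllPairs using ([]; _∷_)
open import Data.List.Relation.Unary.Any using (here; there)
open import Data.List.Relation.Unary.Unique.Propositional using (Unique)
import Data.List.Relation.Unary.Unique.Propositional.Properties as Unique
open import Data.Nat.Base using (ℕ; zero; suc; _+_; _*_; _≤_; _<_; z≤n; s≤s; pred)
open import Data.Nat.Divisibility using (divides; ∣m∣n⇒∣m+n; ∣-refl)
import Data.Nat.Properties as ℕ
open import Data.Product.Base using (Σ; ∃; ∃-syntax; _×_; _,_; proj₁; proj₂)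
open import Data.Sum.Base using (_⊎_; inj₁; inj₂; [_,_]′)
open import Data.Vec.Base using (lookup; tabulate; []; _∷_)
open import Data.Vec.Properties using ([]=⇒lookup; lookup⇒[]=; lookup∘tabulate; ≡-dec)
open import Function.Base using (_∘_; case_of_)
open import Relation.Binary.Definitions using (tri<; tri≈; tri>)
open import Relation.Binary.PropositionalEquality
open import Relation.Nullary using (¬_; Dec; yes; no; does; contradiction)
open import Relation.Nullary.Decidable using (dec-true; dec-false; _×-dec_; _⊎-dec_; ¬?)

private
  variable
    k : ℕ
    A B N : Subset k
    x : Fin k

module _ {n : ℕ} where
  open DecMembership (_≟_ {n}) public using () renaming (_∈?_ to _∈ₗ?_)

-- Symmetric difference

lookup-⊕ : ∀ (A B : Subset k) x → lookup (A ⊕ B) x ≡ lookup A x xor lookup B x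
lookup-⊕ (true  ∷ A) (true  ∷ B) zero = refl
lookup-⊕ (true  ∷ A) (false ∷ B) zero = refl
lookup-⊕ (false ∷ A) (true  ∷ B) zero = refl
lookup-⊕ (false ∷ A) (false ∷ B) zero = refl
lookup-⊕ (_ ∷ A) (_ ∷ B) (suc x) = lookup-⊕ A B x

∉⇒lookup : x ∉ A → lookup A x ≡ false
∉⇒lookup {x = x} {A = A} x∉A with lookup A x in eq
... | true  = contradiction (lookup⇒[]= x A eq) x∉A
... | false = refl

lookup⇒∉ : lookup A x ≡ false → x ∉ A
lookup⇒∉ eq x∈A with () ← trans (sym eq) ([]=⇒lookup x∈A)

∈⊕⁻ : ∀ (A B : Subset k) → x ∈ A ⊕ B → (x ∈ A × x ∉ B) ⊎ (x ∉ A × x ∈ B)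
∈⊕⁻ {x = x} A B x∈ with lookup A x in a | lookup B x in b | trans (sym (lookup-⊕ A B x)) ([]=⇒lookup x∈)
... | true  | false | _ = inj₁ (lookup⇒[]= x A a , lookup⇒∉ b)
... | false | true  | _ = inj₂ (lookup⇒∉ a , lookup⇒[]= x B b)
... | true  | true  | ()
... | false | false | ()

∈⊕⁺ˡ : x ∈ A → x ∉ B → x ∈ A ⊕ B
∈⊕⁺ˡ {x = x} {A = A} {B = B} x∈A x∉B = lookup⇒[]= x _
  (trans (lookup-⊕ A B x) (cong₂ _xor_ ([]=⇒lookup x∈A) (∉⇒lookup x∉B)))

∈⊕⁺ʳ : x ∉ A → x ∈ B → x ∈ A ⊕ B
∈⊕⁺ʳ {x = x} {A = A} {B = B} x∉A x∈B = lookup⇒[]= x _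
  (trans (lookup-⊕ A B x) (cong₂ _xor_ (∉⇒lookup x∉A) ([]=⇒lookup x∈B)))

∉⊕ : x ∈ A → x ∈ B → x ∉ A ⊕ B
∉⊕ {A = A} {B = B} x∈A x∈B x∈ with ∈⊕⁻ A B x∈
... | inj₁ (_ , x∉B) = x∉B x∈B
... | inj₂ (x∉A , _) = x∉A x∈A

⊕-⊆ : ∀ {C : Subset k} → A ⊆ C → B ⊆ C → A ⊕ B ⊆ C
⊕-⊆ {A = A} {B = B} A⊆C B⊆C x∈ with ∈⊕⁻ A B x∈
... | inj₁ (x∈A , _) = A⊆C x∈A
... | inj₂ (_ , x∈B) = B⊆C x∈B

lookup-extensional : (∀ x → lookup A x ≡ lookup B x) → A ≡ B
lookup-extensional A≈B = ⊆-antisym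
  (λ {x} x∈A → lookup⇒[]= x _ (trans (sym (A≈B x)) ([]=⇒lookup x∈A)))
  (λ {x} x∈B → lookup⇒[]= x _ (trans (A≈B x) ([]=⇒lookup x∈B)))

⊕-comm : ∀ (A B : Subset k) → A ⊕ B ≡ B ⊕ A
⊕-comm A B = lookup-extensional λ x →
  trans (lookup-⊕ A B x) (trans (xor-comm (lookup A x) _) (sym (lookup-⊕ B A x)))

⊕-assoc : ∀ (A B C : Subset k) → A ⊕ B ⊕ C ≡ A ⊕ (B ⊕ C)
⊕-assoc A B C = lookup-extensional λ x → begin
  lookup (A ⊕ B ⊕ C) x                            ≡⟨ lookup-⊕ (A ⊕ B) C x ⟩
  lookup (A ⊕ B) x xor lookup C x                 ≡⟨ cong (_xor _) (lookup-⊕ A B x) ⟩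
  (lookup A x xor lookup B x) xor lookup C x      ≡⟨ xor-assoc (lookup A x) _ _ ⟩
  lookup A x xor (lookup B x xor lookup C x)      ≡⟨ cong (lookup A x xor_) (lookup-⊕ B C x) ⟨
  lookup A x xor lookup (B ⊕ C) x                 ≡⟨ lookup-⊕ A (B ⊕ C) x ⟨
  lookup (A ⊕ (B ⊕ C)) x                          ∎
  where open ≡-Reasoning

⊕-identityˡ : ∀ (A : Subset k) → ⊥ ⊕ A ≡ A
⊕-identityˡ A = lookup-extensional λ x →
  trans (lookup-⊕ ⊥ A x) (cong (_xor lookup A x) (∉⇒lookup {x = x} ∉⊥))

⊕-self : ∀ (A : Subset k) → A ⊕ A ≡ ⊥
⊕-self A = lookup-extensional λ x →
  trans (lookup-⊕ A A x) (trans (xor-same (lookup A x)) (sym (∉⇒lookup {x = x} ∉⊥)))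

⊕-cancelˡ : ∀ (A B : Subset k) → A ⊕ (A ⊕ B) ≡ B
⊕-cancelˡ A B = trans (sym (⊕-assoc A A B)) (trans (cong (_⊕ B) (⊕-self A)) (⊕-identityˡ B))

-- Meant for two consecutive chords of a cycle: `Y` is the root path to the far end of the first and
-- `Y ⊕ M` the one to the near end of the second, so only the segment `M` between them survives.
⊕-cancel-middle : ∀ (X Y M E W : Subset k) → (X ⊕ Y) ⊕ (Y ⊕ M ⊕ E ⊕ W) ≡ X ⊕ (M ⊕ E ⊕ W)
⊕-cancel-middle X Y M E W = begin
  (X ⊕ Y) ⊕ (Y ⊕ M ⊕ E ⊕ W)    ≡⟨ ⊕-assoc X Y _ ⟩
  X ⊕ (Y ⊕ (Y ⊕ M ⊕ E ⊕ W))    ≡⟨ cong (λ A → X ⊕ (Y ⊕ (A ⊕ W))) (⊕-assoc Y M E) ⟩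
  X ⊕ (Y ⊕ (Y ⊕ (M ⊕ E) ⊕ W))  ≡⟨ cong (λ A → X ⊕ (Y ⊕ A)) (⊕-assoc Y (M ⊕ E) W) ⟩
  X ⊕ (Y ⊕ (Y ⊕ (M ⊕ E ⊕ W)))  ≡⟨ cong (X ⊕_) (⊕-cancelˡ Y _) ⟩
  X ⊕ (M ⊕ E ⊕ W)              ∎
  where open ≡-Reasoning

⊕≡⊥⇒≡ : ∀ (A B : Subset k) → A ⊕ B ≡ ⊥ → A ≡ B
⊕≡⊥⇒≡ A B eq = begin
  A            ≡⟨ trans (⊕-comm A ⊥) (⊕-identityˡ A) ⟨
  A ⊕ ⊥        ≡⟨ cong (A ⊕_) eq ⟨
  A ⊕ (A ⊕ B)  ≡⟨ ⊕-cancelˡ A B ⟩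
  B            ∎
  where open ≡-Reasoning

∣⊕∣≤ : ∀ (A B : Subset k) → ∣ A ⊕ B ∣ ≤ ∣ A ∣ + ∣ B ∣
∣⊕∣≤ [] [] = z≤n
∣⊕∣≤ (true  ∷ A) (true  ∷ B) = ℕ.m≤n⇒m≤1+n (ℕ.≤-trans (∣⊕∣≤ A B) (ℕ.+-monoʳ-≤ ∣ A ∣ (ℕ.n≤1+n _)))
∣⊕∣≤ (true  ∷ A) (false ∷ B) = s≤s (∣⊕∣≤ A B)
∣⊕∣≤ (false ∷ A) (true  ∷ B) = ℕ.≤-trans (s≤s (∣⊕∣≤ A B)) (ℕ.≤-reflexive (sym (ℕ.+-suc ∣ A ∣ ∣ B ∣)))
∣⊕∣≤ (false ∷ A) (false ∷ B) = ∣⊕∣≤ A B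

∣⁅x⁆∪A∣ : ∀ (x : Fin k) A → x ∉ A → ∣ ⁅ x ⁆ ∪ A ∣ ≡ suc ∣ A ∣
∣⁅x⁆∪A∣ zero    (true  ∷ A) x∉ = contradiction (lookup⇒[]= zero (true ∷ A) refl) x∉
∣⁅x⁆∪A∣ zero    (false ∷ A) x∉ = cong (suc ∘ ∣_∣) (∪-identityˡ A)
∣⁅x⁆∪A∣ (suc x) (true  ∷ A) x∉ = cong suc (∣⁅x⁆∪A∣ x A (x∉ ∘ λ x∈ → lookup⇒[]= (suc x) (true ∷ A) ([]=⇒lookup x∈)))
∣⁅x⁆∪A∣ (suc x) (false ∷ A) x∉ = ∣⁅x⁆∪A∣ x A (x∉ ∘ λ x∈ → lookup⇒[]= (suc x) (false ∷ A) ([]=⇒lookup x∈))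

⁅x⁆∪A≡⁅x⁆⊕A : x ∉ A → ⁅ x ⁆ ∪ A ≡ ⁅ x ⁆ ⊕ A
⁅x⁆∪A≡⁅x⁆⊕A {x = x} {A = A} x∉A = ⊆-antisym to (⊕-⊆ (p⊆p∪q A) (q⊆p∪q ⁅ x ⁆ A))
  where
  to : ⁅ x ⁆ ∪ A ⊆ ⁅ x ⁆ ⊕ A
  to y∈ with x∈p∪q⁻ ⁅ x ⁆ A y∈
  ... | inj₁ y∈⁅x⁆ with refl ← x∈⁅y⁆⇒x≡y x y∈⁅x⁆ = ∈⊕⁺ˡ y∈⁅x⁆ x∉A
  ... | inj₂ y∈A = ∈⊕⁺ʳ (λ y∈⁅x⁆ → x∉A (subst (_∈ A) (x∈⁅y⁆⇒x≡y x y∈⁅x⁆) y∈A)) y∈A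

-- Parity of intersections

odd : ℕ → Bool
odd zero    = false
odd (suc k) = not (odd k)

odd-+ : ∀ i j → odd (i + j) ≡ odd i xor odd j
odd-+ zero    j = refl
odd-+ (suc i) j = trans (cong not (odd-+ i j)) (not-distribˡ-xor (odd i) (odd j))

odd-double : ∀ i → odd (i + i) ≡ false
odd-double i = trans (odd-+ i i) (xor-same (odd i))

i*2≡i+i : ∀ i → i * 2 ≡ i + i
i*2≡i+i i = trans (ℕ.*-comm i 2) (cong (i +_) (ℕ.+-identityʳ i))

even⇒odd≡false : Even k → odd k ≡ false
even⇒odd≡false (divides q refl) = trans (cong odd (i*2≡i+i q)) (odd-double q)

odd≡false⇒even : ∀ k → odd k ≡ false → Even k
odd≡false⇒even zero          _  = divides 0 refl
odd≡false⇒even (suc (suc k)) eq =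
  ∣m∣n⇒∣m+n ∣-refl (odd≡false⇒even k (trans (sym (not-involutive (odd k))) eq))

infix 7 _∙_

-- The mod-2 inner product. Against a star it gives the boundary at a vertex, against the negative
-- edges the sidedness, against `⊤` the parity of the length.
_∙_ : Subset k → Subset k → Bool
A ∙ N = odd ∣ A ∩ N ∣

∙-distribʳ-⊕ : ∀ (N A B : Subset k) → (A ⊕ B) ∙ N ≡ A ∙ N xor B ∙ N
∙-distribʳ-⊕ [] [] [] = refl
∙-distribʳ-⊕ (true  ∷ N) (true  ∷ A) (true  ∷ B) =
  trans (∙-distribʳ-⊕ N A B) (sym (trans (sym (not-distribˡ-xor (A ∙ N) _)) (trans (cong not (sym (not-distribʳ-xor (A ∙ N) (B ∙ N)))) (not-involutive _))))
∙-distribʳ-⊕ (true  ∷ N) (true  ∷ A) (false ∷ B) = trans (cong not (∙-distribʳ-⊕ N A B)) (not-distribˡ-xor (A ∙ N) _)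
∙-distribʳ-⊕ (true  ∷ N) (false ∷ A) (true  ∷ B) = trans (cong not (∙-distribʳ-⊕ N A B)) (not-distribʳ-xor (A ∙ N) _)
∙-distribʳ-⊕ (true  ∷ N) (false ∷ A) (false ∷ B) = ∙-distribʳ-⊕ N A B
∙-distribʳ-⊕ (false ∷ N) (true  ∷ A) (true  ∷ B) = ∙-distribʳ-⊕ N A B
∙-distribʳ-⊕ (false ∷ N) (true  ∷ A) (false ∷ B) = ∙-distribʳ-⊕ N A B
∙-distribʳ-⊕ (false ∷ N) (false ∷ A) (true  ∷ B) = ∙-distribʳ-⊕ N A B
∙-distribʳ-⊕ (false ∷ N) (false ∷ A) (false ∷ B) = ∙-distribʳ-⊕ N A B

⊥∙ : ∀ (N : Subset k) → ⊥ ∙ N ≡ false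
⊥∙ {k} N = cong odd (trans (cong ∣_∣ (∩-zeroˡ N)) (∣⊥∣≡0 k))

⁅x⁆∙ : ∀ (x : Fin k) N → ⁅ x ⁆ ∙ N ≡ lookup N x
⁅x⁆∙ zero    (true  ∷ N) = cong not (⊥∙ N)
⁅x⁆∙ zero    (false ∷ N) = ⊥∙ N
⁅x⁆∙ (suc x) (_ ∷ N)     = ⁅x⁆∙ x N

∙⊤ : ∀ (A : Subset k) → A ∙ ⊤ ≡ odd ∣ A ∣
∙⊤ A = cong (odd ∘ ∣_∣) (∩-identityʳ A)

∙≡true⇒meet : ∀ (A N : Subset k) → A ∙ N ≡ true → ∃[ x ] (x ∈ A × x ∈ N)
∙≡true⇒meet {k} A N eq with nonempty? (A ∩ N)
... | yes (x , x∈) = x , x∈p∩q⁻ A N x∈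
... | no empty with () ← trans (sym eq) (cong odd (trans (cong ∣_∣ (Empty-unique empty)) (∣⊥∣≡0 k)))

-- Lists without repetition

module _ {A : Set} where

  unique-lookup-injective : ∀ {xs : List A} → Unique xs → ∀ {i j} → List.lookup xs i ≡ List.lookup xs j → i ≡ j
  unique-lookup-injective (_ ∷ _) {zero}  {zero}  _  = refl
  unique-lookup-injective (x∉ ∷ _) {zero} {suc j} eq = contradiction eq (All.lookup x∉ (∈-lookup j))
  unique-lookup-injective (x∉ ∷ _) {suc i} {zero} eq = contradiction (sym eq) (All.lookup x∉ (∈-lookup i))
  unique-lookup-injective (_ ∷ u) {suc i} {suc j} eq = cong suc (unique-lookup-injective u eq)

  all≢⇒∉ : ∀ {x : A} {xs} → All (x ≢_) xs → x ∉ₗ xs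
  all≢⇒∉ = All¬⇒¬Any

  ∉⇒all≢ : ∀ {x : A} {xs} → x ∉ₗ xs → All (x ≢_) xs
  ∉⇒all≢ = ¬Any⇒All¬ _

  -- `IsPath` puts the final vertex last; the closed walk that begins with an edge from that vertex
  -- back to the start lists it first.
  unique-∷ʳ⁻ : ∀ (xs : List A) {x} → Unique (xs ∷ʳ x) → Unique (x ∷ xs)
  unique-∷ʳ⁻ []       u        = [] ∷ []
  unique-∷ʳ⁻ (y ∷ xs) (y∉ ∷ u) with unique-∷ʳ⁻ xs u
  ... | x∉ ∷ u′ = (≢-sym (All.lookup y∉ (∈-++⁺ʳ xs (here refl))) ∷ x∉)
                ∷ (All.tabulate (λ z∈ → All.lookup y∉ (∈-++⁺ˡ z∈)) ∷ u′)

  unique-∷ʳ⁺ : ∀ (xs : List A) {x} → Unique (x ∷ xs) → Unique (xs ∷ʳ x)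
  unique-∷ʳ⁺ xs (x∉ ∷ u) = Unique.++⁺ u ([] ∷ []) λ { (x∈ , here refl) → all≢⇒∉ x∉ x∈ }

module _ {n m : ℕ} (G : Graph n m) where
  open Graph G

  private
    variable
      u v w : Fin n
      e f : Fin m

  joins-sym : Joins G e u v → Joins G e v u
  joins-sym (inj₁ eq) = inj₂ eq
  joins-sym (inj₂ eq) = inj₁ eq

  joins-ends : ∀ e → Joins G e (proj₁ (ends e)) (proj₂ (ends e))
  joins-ends e = inj₁ refl

  joins-unique : ∀ {x y} → Joins G e u v → Joins G e x y → (x ≡ u × y ≡ v) ⊎ (x ≡ v × y ≡ u)
  joins-unique (inj₁ p) (inj₁ q) with refl ← trans (sym p) q = inj₁ (refl , refl)
  joins-unique (inj₁ p) (inj₂ q) with refl ← trans (sym p) q = inj₂ (refl , refl)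
  joins-unique (inj₂ p) (inj₁ q) with refl ← trans (sym p) q = inj₂ (refl , refl)
  joins-unique (inj₂ p) (inj₂ q) with refl ← trans (sym p) q = inj₁ (refl , refl)

  -- Edge sets as mod-2 chains

  -- A loop is in no star, which makes it a cycle of the mod-2 boundary map.
  star : Fin n → Subset m
  star v = tabulate λ e → does (proj₁ (ends e) ≟ v) xor does (proj₂ (ends e) ≟ v)

  lookup-star : Joins G e u v → ∀ w → lookup (star w) e ≡ does (u ≟ w) xor does (v ≟ w)
  lookup-star {e} (inj₁ p) w rewrite lookup∘tabulate (λ e → does (proj₁ (ends e) ≟ w) xor does (proj₂ (ends e) ≟ w)) e | p = refl
  lookup-star {e} {u} {v} (inj₂ p) w rewrite lookup∘tabulate (λ e → does (proj₁ (ends e) ≟ w) xor does (proj₂ (ends e) ≟ w)) e | p = xor-comm (does (v ≟ w)) _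

  ∈star⇒joins : e ∈ star u → ∃[ v ] (Joins G e u v × u ≢ v)
  ∈star⇒joins {e} {u} e∈ = from-ends (joins-ends e)
    where
    from-ends : ∀ {a b} → Joins G e a b → ∃[ v ] (Joins G e u v × u ≢ v)
    from-ends {a} {b} j with a ≟ u | b ≟ u | trans (sym (lookup-star j u)) ([]=⇒lookup e∈)
    ... | yes refl | no b≢u | _ = b , j , ≢-sym b≢u
    ... | no a≢u | yes refl | _ = a , joins-sym j , ≢-sym a≢u
    ... | yes _ | yes _ | ()
    ... | no _ | no _ | ()

  joins⇒∈star : Joins G e u v → u ≢ v → e ∈ star u
  joins⇒∈star {e} {u} {v} j u≢v = lookup⇒[]= e _ (trans (lookup-star j u)
    (cong₂ _xor_ (dec-true (u ≟ u) refl) (dec-false (v ≟ u) (≢-sym u≢v))))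

  -- The mod-2 boundary of `A` is the sum of `u` and `v`, which vanishes when they coincide.
  record Boundary (A : Subset m) (u v : Fin n) : Set where
    constructor boundary
    field
      ∂ : ∀ w → A ∙ star w ≡ does (u ≟ w) xor does (v ≟ w)
  open Boundary

  -- Membership in the cycle space over the field with two elements.
  record Balanced (A : Subset m) : Set where
    constructor balanced
    field
      ∂≡0 : ∀ w → A ∙ star w ≡ false
  open Balanced

  boundary⇒balanced : Boundary A u u → Balanced A
  boundary⇒balanced {u = u} bd = balanced λ w → trans (∂ bd w) (xor-same (does (u ≟ w)))

  ⊥-boundary : Boundary ⊥ u u
  ⊥-boundary {u} = boundary λ w → trans (⊥∙ (star w)) (sym (xor-same (does (u ≟ w))))

  ⁅⁆-boundary : Joins G e u v → Boundary ⁅ e ⁆ u v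
  ⁅⁆-boundary {e} j = boundary λ w → trans (⁅x⁆∙ e (star w)) (lookup-star j w)

  boundary-sym : Boundary A u v → Boundary A v u
  boundary-sym {u = u} {v} bA = boundary λ w → trans (∂ bA w) (xor-comm (does (u ≟ w)) _)

  boundary-⊕ : Boundary A u v → Boundary B v w → Boundary (A ⊕ B) u w
  boundary-⊕ {A = A} {u} {v} {B} {w} bA bB = boundary λ z →
    trans (∙-distribʳ-⊕ (star z) A B) (trans (cong₂ _xor_ (∂ bA z) (∂ bB z))
      (telescope (does (u ≟ z)) (does (v ≟ z)) (does (w ≟ z))))
    where
    telescope : ∀ a b c → (a xor b) xor (b xor c) ≡ a xor c
    telescope a b c = begin
      (a xor b) xor (b xor c) ≡⟨ xor-assoc a b _ ⟩
      a xor (b xor (b xor c)) ≡⟨ cong (a xor_) (xor-assoc b b c) ⟨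
      a xor ((b xor b) xor c) ≡⟨ cong (λ t → a xor (t xor c)) (xor-same b) ⟩
      a xor c                 ∎
      where open ≡-Reasoning

  balanced-⊕ : Balanced A → Balanced B → Balanced (A ⊕ B)
  balanced-⊕ {A = A} {B} bA bB = balanced λ w → trans (∙-distribʳ-⊕ (star w) A B) (cong₂ _xor_ (∂≡0 bA w) (∂≡0 bB w))

  -- Every vertex meets a balanced edge set in zero or at least two non-loop edges.
  balanced-continue : Balanced A → Joins G e u v → u ≢ v → e ∈ A →
    ∃[ f ] (f ∈ A × f ≢ e × f ∈ star u)
  balanced-continue {A = A} {e} {u} bA j u≢v e∈A
    with ∙≡true⇒meet (⁅ e ⁆ ⊕ A) (star u) (trans (∙-distribʳ-⊕ (star u) ⁅ e ⁆ A)
           (cong₂ _xor_ (trans (⁅x⁆∙ e (star u)) ([]=⇒lookup (joins⇒∈star j u≢v))) (∂≡0 bA u)))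
  ... | f , f∈ , f∈star with ∈⊕⁻ ⁅ e ⁆ A f∈
  ... | inj₂ (f∉ , f∈A) = f , f∈A , x∉⁅y⁆⇒x≢y f∉ , f∈star
  ... | inj₁ (f∈e , f∉A) = contradiction (subst (_∈ A) (sym (x∈⁅y⁆⇒x≡y e f∈e)) e∈A) f∉A

  -- Walks

  vertices : Walk G u v → List (Fin n)
  vertices {v = v} p = sources G p ∷ʳ v

  start∈vertices : (p : Walk G u v) → u ∈ₗ vertices p
  start∈vertices []           = here refl
  start∈vertices (step _ _ _) = here refl

  ends∈vertices : ∀ {x y} (p : Walk G u v) → e ∈ₗ edges G p → Joins G e x y → x ∈ₗ vertices p
  ends∈vertices (step _ i p) (here refl) j with joins-unique i j
  ... | inj₁ (refl , refl) = here refl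
  ... | inj₂ (refl , refl) = there (start∈vertices p)
  ends∈vertices (step _ i p) (there e∈) j = there (ends∈vertices p e∈ j)

  path⇒unique-edges : (p : Walk G u v) → IsPath G p → Unique (edges G p)
  path⇒unique-edges []           _        = []
  path⇒unique-edges (step e j p) (u∉ ∷ π) =
    ∉⇒all≢ (λ e∈ → all≢⇒∉ u∉ (ends∈vertices p e∈ j)) ∷ path⇒unique-edges p π

  ∈edgeSet⁺ : (p : Walk G u v) → e ∈ₗ edges G p → e ∈ edgeSet G p
  ∈edgeSet⁺ (step e j p) (here refl) = x∈p∪q⁺ (inj₁ (x∈⁅x⁆ e))
  ∈edgeSet⁺ (step _ j p) (there e∈)  = x∈p∪q⁺ (inj₂ (∈edgeSet⁺ p e∈))

  ∈edgeSet⁻ : (p : Walk G u v) → e ∈ edgeSet G p → e ∈ₗ edges G p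
  ∈edgeSet⁻ []           e∈ = contradiction e∈ ∉⊥
  ∈edgeSet⁻ (step f j p) e∈ with x∈p∪q⁻ ⁅ f ⁆ (edgeSet G p) e∈
  ... | inj₁ e∈f = here (x∈⁅y⁆⇒x≡y f e∈f)
  ... | inj₂ e∈p = there (∈edgeSet⁻ p e∈p)

  edgeSet-boundary : (p : Walk G u v) → Unique (edges G p) → Boundary (edgeSet G p) u v
  edgeSet-boundary []           _       = ⊥-boundary
  edgeSet-boundary (step e j p) (e∉ ∷ π) = subst (λ A → Boundary A _ _)
    (sym (⁅x⁆∪A≡⁅x⁆⊕A (all≢⇒∉ e∉ ∘ ∈edgeSet⁻ p)))
    (boundary-⊕ (⁅⁆-boundary j) (edgeSet-boundary p π))

  ∣edgeSet∣ : (p : Walk G u v) → Unique (edges G p) → ∣ edgeSet G p ∣ ≡ length G p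
  ∣edgeSet∣ []           _        = ∣⊥∣≡0 m
  ∣edgeSet∣ (step e j p) (e∉ ∷ π) =
    trans (∣⁅x⁆∪A∣ e (edgeSet G p) (all≢⇒∉ e∉ ∘ ∈edgeSet⁻ p)) (cong suc (∣edgeSet∣ p π))

  from-vertex : (p : Walk G u v) → w ∈ₗ vertices p → Σ (Walk G w v) λ q →
    (IsPath G p → IsPath G q) × (∀ {e} → e ∈ₗ edges G q → e ∈ₗ edges G p) × length G q ≤ length G p
  from-vertex []           (here refl) = [] , (λ π → π) , (λ e∈ → e∈) , z≤n
  from-vertex (step e j p) (here refl) = step e j p , (λ π → π) , (λ e∈ → e∈) , ℕ.≤-refl
  from-vertex (step e j p) (there w∈) with from-vertex p w∈
  ... | q , path , sub , len = q , (λ { (_ ∷ π) → path π }) , there ∘ sub , ℕ.m≤n⇒m≤1+n len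

  to-vertex : (p : Walk G u v) → w ∈ₗ vertices p → Σ (Walk G u w) λ q →
    (IsPath G p → IsPath G q) × (∀ {e} → e ∈ₗ edges G q → e ∈ₗ edges G p) ×
    (∀ {x} → x ∈ₗ vertices q → x ∈ₗ vertices p)
  to-vertex []           (here refl) = [] , (λ π → π) , (λ e∈ → e∈) , (λ x∈ → x∈)
  to-vertex (step e j p) (here refl) = [] , (λ _ → [] ∷ []) , (λ ()) , λ { (here refl) → here refl }
  to-vertex (step e j p) (there w∈) with to-vertex p w∈
  ... | q , path , sub , vsub =
    step e j q ,
    (λ { (u∉ ∷ π) → All.tabulate (λ x∈ → All.lookup u∉ (vsub x∈)) ∷ path π }) ,
    (λ { (here refl) → here refl ; (there e∈) → there (sub e∈) }) ,
    (λ { (here refl) → here refl ; (there x∈) → there (vsub x∈) })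

  erase-loops : (p : Walk G u v) → Σ (Walk G u v) λ q →
    IsPath G q × (∀ {e} → e ∈ₗ edges G q → e ∈ₗ edges G p) × length G q ≤ length G p
  erase-loops []                   = [] , [] ∷ [] , (λ e∈ → e∈) , z≤n
  erase-loops (step {u = u} e j p) with erase-loops p
  ... | q , π , sub , len with u ∈ₗ? vertices q
  ... | no u∉ = step e j q , ∉⇒all≢ u∉ ∷ π ,
                (λ { (here refl) → here refl ; (there e∈) → there (sub e∈) }) , s≤s len
  ... | yes u∈ with from-vertex q u∈
  ... | q′ , path , sub′ , len′ = q′ , path π , there ∘ sub ∘ sub′ , ℕ.m≤n⇒m≤1+n (ℕ.≤-trans len′ len)

  snoc : Walk G u v → Joins G e v w → Walk G u w
  snoc []            j = step _ j []
  snoc (step e j′ p) j = step e j′ (snoc p j)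

  length-snoc : (p : Walk G u v) (j : Joins G e v w) → length G (snoc p j) ≡ suc (length G p)
  length-snoc []           j = refl
  length-snoc (step _ _ p) j = cong suc (length-snoc p j)

  length-vertices : (p : Walk G u v) → List.length (vertices p) ≡ suc (length G p)
  length-vertices []           = refl
  length-vertices (step _ _ p) = cong suc (length-vertices p)

  -- Pigeonhole on the vertices; this bounds the number of prolongations in `extend`.
  path-length< : (p : Walk G u v) → IsPath G p → length G p < n
  path-length< p π = subst (_≤ n) (length-vertices p) (injective⇒≤ (unique-lookup-injective π))

  -- Cycles

  close-path : (p : Walk G u v) → IsPath G p → Joins G e v u → e ∉ₗ edges G p →
    IsCycle G (⁅ e ⁆ ∪ edgeSet G p)
  close-path {v = v} {e = e} p π j e∉ =
    v , step e j p , (λ ()) , unique-∷ʳ⁻ (sources G p) π , ∉⇒all≢ e∉ ∷ path⇒unique-edges p π , refl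

  loop-cycle : Joins G e u u → IsCycle G ⁅ e ⁆
  loop-cycle {e} j = subst (IsCycle G) (∪-identityʳ ⁅ e ⁆) (close-path [] ([] ∷ []) j (λ ()))

  private
    -- The path is prolonged backwards inside A until it runs into itself.
    extend : Balanced A → ∀ fuel (j : Joins G e u v) (p : Walk G v w) → IsPath G (step e j p) →
      (∀ {f} → f ∈ₗ edges G (step e j p) → f ∈ A) → n ≤ fuel + length G (step e j p) →
      ∃[ C ] (IsCycle G C × C ⊆ A)
    extend bA zero j p π sub n≤ = contradiction (path-length< (step _ j p) π) (ℕ.≤⇒≯ n≤)
    extend {A = A} {e} {u} {v} bA (suc fuel) j p π@(u∉ ∷ _) sub n≤
      with balanced-continue bA j (λ { refl → all≢⇒∉ u∉ (start∈vertices p) }) (sub (here refl))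
    ... | f , f∈A , f≢e , f∈star with ∈star⇒joins f∈star
    ... | x , i , u≢x with x ∈ₗ? vertices (step e j p)
    ... | no x∉ = extend bA fuel (joins-sym i) (step e j p) (∉⇒all≢ x∉ ∷ π)
                    (λ { (here refl) → f∈A ; (there g∈) → sub g∈ })
                    (subst (n ≤_) (sym (ℕ.+-suc fuel _)) n≤)
    ... | yes x∈ with to-vertex (step e j p) x∈
    ... | q , path , sub′ , _ = _ , close-path q (path π) (joins-sym i) f∉q , ⊆A
      where
      -- `f` ends at `u`, which the path visits only as its first vertex, so the only edge of the
      -- path that could be `f` is `e`.
      f∉p : f ∉ₗ edges G (step e j p)
      f∉p (here refl) = f≢e refl
      f∉p (there f∈)  = all≢⇒∉ u∉ (ends∈vertices p f∈ i)
      f∉q : f ∉ₗ edges G q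
      f∉q = f∉p ∘ sub′
      ⊆A : ⁅ f ⁆ ∪ edgeSet G q ⊆ A
      ⊆A g∈ with x∈p∪q⁻ ⁅ f ⁆ (edgeSet G q) g∈
      ... | inj₁ g∈f = subst (_∈ A) (sym (x∈⁅y⁆⇒x≡y f g∈f)) f∈A
      ... | inj₂ g∈q = sub (sub′ (∈edgeSet⁻ q g∈q))

  balanced⇒∃cycle : Balanced A → Nonempty A → ∃[ C ] (IsCycle G C × C ⊆ A)
  balanced⇒∃cycle {A = A} bA (e , e∈A) with ends e in eq
  ... | u , v with u ≟ v
  ... | yes refl = ⁅ e ⁆ , loop-cycle (inj₁ eq) , λ f∈ → subst (_∈ A) (sym (x∈⁅y⁆⇒x≡y e f∈)) e∈A
  ... | no u≢v = extend bA n (inj₁ eq) [] ((u≢v ∷ []) ∷ [] ∷ []) (λ { (here refl) → e∈A }) (ℕ.m≤m+n n 1)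

  cycle-balanced : ∀ {C} → IsCycle G C → Balanced C
  cycle-balanced (v , w , _ , _ , π , refl) = boundary⇒balanced (edgeSet-boundary w π)

  -- At the first edge of the path lying in `A`, balance at its near end demands a second edge of
  -- `A` there, but the rest of the path avoids that vertex.
  path-acyclic : (p : Walk G u v) → IsPath G p → Balanced A → A ⊆ edgeSet G p → Empty A
  path-acyclic [] _ bA sub (e , e∈) = contradiction (sub e∈) ∉⊥
  path-acyclic {A = A} (step {u = u} {v = v} e j p) (u∉ ∷ π) bA sub ne with e ∈? A
  ... | no e∉ = path-acyclic p π bA sub′ ne
    where
    sub′ : A ⊆ edgeSet G p
    sub′ f∈ with x∈p∪q⁻ ⁅ e ⁆ (edgeSet G p) (sub f∈)
    ... | inj₁ f∈e = contradiction (subst (_∈ A) (x∈⁅y⁆⇒x≡y e f∈e) f∈) e∉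
    ... | inj₂ f∈p = f∈p
  ... | yes e∈ with balanced-continue bA j (λ { refl → all≢⇒∉ u∉ (start∈vertices p) }) e∈
  ... | f , f∈A , f≢e , f∈star with ∈edgeSet⁻ (step e j p) (sub f∈A)
  ... | here f≡e = f≢e f≡e
  ... | there f∈ = all≢⇒∉ u∉ (ends∈vertices p f∈ (proj₁ (proj₂ (∈star⇒joins f∈star))))

  -- Removing one edge `e` from the cycle leaves a path, which is acyclic. If `A` missed `e` it
  -- would be empty; if it contains `e`, then `A ⊕ C` misses `e` and is empty.
  cycle-minimal : ∀ {C} → IsCycle G C → Balanced A → Nonempty A → A ⊆ C → A ≡ C
  cycle-minimal (v , [] , ≢[] , _) _ _ _ = contradiction refl ≢[]
  cycle-minimal {A = A} cyc@(v , step e j p , _ , uv , (e∉ ∷ _) , refl) bA ne sub = by-edge (e ∈? A)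
    where
    C = ⁅ e ⁆ ∪ edgeSet G p
    π : IsPath G p
    π = unique-∷ʳ⁺ (sources G p) uv
    without-e : ∀ {D} → D ⊆ C → e ∉ D → D ⊆ edgeSet G p
    without-e {D} D⊆ e∉D f∈ with x∈p∪q⁻ ⁅ e ⁆ (edgeSet G p) (D⊆ f∈)
    ... | inj₁ f∈e = contradiction (subst (_∈ D) (x∈⁅y⁆⇒x≡y e f∈e) f∈) e∉D
    ... | inj₂ f∈p = f∈p
    by-edge : Dec (e ∈ A) → A ≡ C
    by-edge (no e∉A) = contradiction ne (path-acyclic p π bA (without-e sub e∉A))
    by-edge (yes e∈A) = ⊕≡⊥⇒≡ A C (Empty-unique (path-acyclic p π (balanced-⊕ bA (cycle-balanced cyc))
      (without-e (⊕-⊆ sub (λ f∈ → f∈)) (∉⊕ e∈A (p⊆p∪q (edgeSet G p) (x∈⁅x⁆ e))))))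

-- The order of the edges along a walk

module _ {n m : ℕ} (G : Graph n m) where

  private
    variable
      u v : Fin n
      a b : Fin m

  -- `s` may be either end of `a`; if it is the one reached second, `A` includes `a` itself.
  edge-prefix : ∀ {s t} (p : Walk G u v) → a ∈ₗ edges G p → Joins G a s t →
    ∃[ A ] (Boundary G A u s × A ⊆ edgeSet G p)
  edge-prefix (step e j p) (here refl) i with joins-unique G j i
  ... | inj₁ (refl , refl) = ⊥ , ⊥-boundary G , λ x∈ → contradiction x∈ ∉⊥
  ... | inj₂ (refl , refl) = ⁅ e ⁆ , ⁅⁆-boundary G j , p⊆p∪q (edgeSet G p)
  edge-prefix (step e j p) (there a∈) i with edge-prefix p a∈ i
  ... | A , bA , A⊆p = ⁅ e ⁆ ⊕ A , boundary-⊕ G (⁅⁆-boundary G j) bA ,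
    ⊕-⊆ (p⊆p∪q (edgeSet G p)) (λ x∈ → q⊆p∪q ⁅ e ⁆ (edgeSet G p) (A⊆p x∈))

  -- `A` stands for the piece of `p` leading to an end of `b`. Recording it by its boundary is
  -- enough, since in a tree the boundary determines the edge set.
  Precedes : Walk G u v → Fin m → Fin m → Set
  Precedes {u} p a b =
    ∃[ s ] ∃[ t ] ∃[ A ] (Joins G b s t × Boundary G A u s × A ⊆ edgeSet G p × a ∈ A)

  private
    first-precedes : ∀ {w} (j : Joins G a w u) (p : Walk G u v) → a ∉ₗ edges G p → b ∈ₗ edges G p →
      Precedes (step a j p) a b
    first-precedes {a = a} {b = b} j p a∉ b∈ with edge-prefix p b∈ (joins-ends G b)
    ... | A , bA , A⊆p = _ , _ , ⁅ a ⁆ ⊕ A , joins-ends G b , boundary-⊕ G (⁅⁆-boundary G j) bA ,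
      ⊕-⊆ (p⊆p∪q (edgeSet G p)) (λ x∈ → q⊆p∪q ⁅ a ⁆ (edgeSet G p) (A⊆p x∈)) ,
      ∈⊕⁺ˡ (x∈⁅x⁆ a) (λ a∈A → a∉ (∈edgeSet⁻ G p (A⊆p a∈A)))

    step-precedes : ∀ {e w} (j : Joins G e w u) (p : Walk G u v) → e ∉ₗ edges G p → Precedes p a b →
      Precedes (step e j p) a b
    step-precedes {e = e} j p e∉ (s , t , A , i , bA , A⊆p , a∈A) =
      s , t , ⁅ e ⁆ ⊕ A , i , boundary-⊕ G (⁅⁆-boundary G j) bA ,
      ⊕-⊆ (p⊆p∪q (edgeSet G p)) (λ x∈ → q⊆p∪q ⁅ e ⁆ (edgeSet G p) (A⊆p x∈)) ,
      ∈⊕⁺ʳ (λ a∈e → e∉ (∈edgeSet⁻ G p (A⊆p (subst (_∈ A) (x∈⁅y⁆⇒x≡y e a∈e) a∈A)))) a∈A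

  path-edges-ordered : (p : Walk G u v) → Unique (edges G p) → a ∈ₗ edges G p → b ∈ₗ edges G p →
    a ≡ b ⊎ Precedes p a b ⊎ Precedes p b a
  path-edges-ordered (step e j p) (e∉ ∷ π) (here refl) (here refl) = inj₁ refl
  path-edges-ordered (step e j p) (e∉ ∷ π) (here refl) (there b∈) = inj₂ (inj₁ (first-precedes j p (all≢⇒∉ e∉) b∈))
  path-edges-ordered (step e j p) (e∉ ∷ π) (there a∈) (here refl) = inj₂ (inj₂ (first-precedes j p (all≢⇒∉ e∉) a∈))
  path-edges-ordered (step e j p) (e∉ ∷ π) (there a∈) (there b∈) with path-edges-ordered p π a∈ b∈
  ... | inj₁ a≡b = inj₁ a≡b
  ... | inj₂ (inj₁ ab) = inj₂ (inj₁ (step-precedes j p (all≢⇒∉ e∉) ab))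
  ... | inj₂ (inj₂ ba) = inj₂ (inj₂ (step-precedes j p (all≢⇒∉ e∉) ba))

-- Root paths and fundamental cycles of a breadth-first-search tree

module Rooted {n m : ℕ} (G : Graph n m) {z : Fin n} {T : Subset m} (bfs : IsBFSTree G z T) where
  open Graph G

  private
    variable
      u v w : Fin n
      a b e f : Fin m

  tree-balanced : Balanced G A → A ⊆ T → A ≡ ⊥
  tree-balanced {A = A} bA A⊆T with nonempty? A
  ... | no empty = Empty-unique empty
  ... | yes ne with balanced⇒∃cycle G bA ne
  ... | C , cyc , C⊆A = ⊥-elim (proj₂ (proj₁ bfs) C cyc (λ x∈ → A⊆T (C⊆A x∈)))

  -- The sum of the two sets is balanced and lies in the tree, which contains no cycle.
  tree-boundary-unique : Boundary G A u v → Boundary G B u v → A ⊆ T → B ⊆ T → A ≡ B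
  tree-boundary-unique bA bB A⊆T B⊆T = ⊕≡⊥⇒≡ _ _ (tree-balanced
    (boundary⇒balanced G (boundary-⊕ G bA (boundary-sym G bB))) (⊕-⊆ A⊆T B⊆T))

  -- An element of the cycle space is determined by its edges outside the tree, since the others
  -- cancel to a balanced subset of the tree.
  balanced-unique : Balanced G A → Balanced G B → (∀ {g} → g ∉ T → g ∈ A → g ∈ B) →
    (∀ {g} → g ∉ T → g ∈ B → g ∈ A) → A ≡ B
  balanced-unique {A = A} {B = B} bA bB A⇒B B⇒A = ⊕≡⊥⇒≡ A B (tree-balanced (balanced-⊕ G bA bB) ⊆T)
    where
    ⊆T : A ⊕ B ⊆ T
    ⊆T {g} g∈ with g ∈? T | ∈⊕⁻ A B g∈
    ... | yes g∈T | _ = g∈T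
    ... | no g∉T | inj₁ (g∈A , g∉B) = contradiction (A⇒B g∉T g∈A) g∉B
    ... | no g∉T | inj₂ (g∉A , g∈B) = contradiction (B⇒A g∉T g∈B) g∉A

  abstract
    tree-path : ∀ v → Σ (Walk G z v) λ p → IsPath G p × edgeSet G p ⊆ T
    tree-path v with proj₁ (proj₁ bfs) z v
    ... | p , p⊆T with erase-loops G p
    ... | q , π , sub , _ = q , π , λ x∈ → p⊆T (∈edgeSet⁺ G p (sub (∈edgeSet⁻ G q x∈)))

  path : ∀ v → Walk G z v
  path v = proj₁ (tree-path v)

  path-unique : ∀ v → Unique (edges G (path v))
  path-unique v = path⇒unique-edges G (path v) (proj₁ (proj₂ (tree-path v)))

  τ : Fin n → Subset m
  τ v = edgeSet G (path v)

  dist : Fin n → ℕ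
  dist v = ∣ τ v ∣

  τ⊆T : ∀ v → τ v ⊆ T
  τ⊆T v = proj₂ (proj₂ (tree-path v))

  τ-boundary : ∀ v → Boundary G (τ v) z v
  τ-boundary v = edgeSet-boundary G (path v) (path-unique v)

  τ-root : τ z ≡ ⊥
  τ-root = tree-boundary-unique (τ-boundary z) (⊥-boundary G) (τ⊆T z) (λ x∈ → contradiction x∈ ∉⊥)

  -- Valid whichever end is nearer to the root: if it is `v`, adding `e` cancels the last edge of
  -- `τ u`.
  τ-step : e ∈ T → Joins G e u v → τ v ≡ τ u ⊕ ⁅ e ⁆
  τ-step {e} {u} {v} e∈T j = tree-boundary-unique (τ-boundary v)
    (boundary-⊕ G (τ-boundary u) (⁅⁆-boundary G j)) (τ⊆T v)
    (⊕-⊆ (τ⊆T u) (λ x∈ → subst (_∈ T) (sym (x∈⁅y⁆⇒x≡y e x∈)) e∈T))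

  dist≡length : ∀ v → dist v ≡ length G (path v)
  dist≡length v = ∣edgeSet∣ G (path v) (path-unique v)

  dist-root : dist z ≡ 0
  dist-root = trans (cong ∣_∣ τ-root) (∣⊥∣≡0 m)

  -- The one place where the breadth-first property enters: the root path to `u` followed by `e`
  -- competes with the root path to `v`.
  dist-lipschitz : Joins G e u v → dist v ≤ suc (dist u)
  dist-lipschitz {e} {u} {v} j with erase-loops G (snoc G (path u) j)
  ... | q , π , _ , len = begin
    dist v                        ≡⟨ dist≡length v ⟩
    length G (path v)             ≤⟨ proj₂ (proj₂ bfs v (path v) (proj₁ (proj₂ (tree-path v))) (τ⊆T v)) q π ⟩
    length G q                    ≤⟨ len ⟩
    length G (snoc G (path u) j)  ≡⟨ length-snoc G (path u) j ⟩
    suc (length G (path u))       ≡⟨ cong suc (dist≡length u) ⟨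
    suc (dist u)                  ∎
    where open ℕ.≤-Reasoning

  -- The piece of a root path up to an end of one of its edges lies in the tree, so it is the root
  -- path of that end.
  τ-closed : b ∈ τ w → Joins G b u v → τ u ⊆ τ w
  τ-closed {w = w} b∈ j with edge-prefix G (path w) (∈edgeSet⁻ G (path w) b∈) j
  ... | A , bA , A⊆ = subst (_⊆ τ w)
    (tree-boundary-unique bA (τ-boundary _) (λ x∈ → τ⊆T w (A⊆ x∈)) (τ⊆T _)) A⊆

  -- The piece witnessing precedence is the root path of an end of `b`, hence part of every root
  -- path through `b`.
  precedes⇒∈τ : Precedes G (path v) a b → ∀ w → b ∈ τ w → a ∈ τ w
  precedes⇒∈τ {v} (s , t , A , j , bA , A⊆ , a∈A) w b∈w = τ-closed b∈w j (subst (_ ∈_)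
    (tree-boundary-unique bA (τ-boundary s) (λ x∈ → τ⊆T v (A⊆ x∈)) (τ⊆T s)) a∈A)

  -- The edges of a root path are linearly ordered by being passed on the way from the root.
  τ-laminar : a ∈ τ v → b ∈ τ v → (∀ w → b ∈ τ w → a ∈ τ w) ⊎ (∀ w → a ∈ τ w → b ∈ τ w)
  τ-laminar {v = v} a∈ b∈
    with path-edges-ordered G (path v) (path-unique v) (∈edgeSet⁻ G (path v) a∈) (∈edgeSet⁻ G (path v) b∈)
  ... | inj₁ refl = inj₁ λ w x∈ → x∈
  ... | inj₂ (inj₁ ab) = inj₁ (precedes⇒∈τ ab)
  ... | inj₂ (inj₂ ba) = inj₂ (precedes⇒∈τ ba)

  -- The fundamental cycle of e if e ∉ T, and empty otherwise.
  Z : Fin m → Subset m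
  Z e = τ (proj₁ (ends e)) ⊕ ⁅ e ⁆ ⊕ τ (proj₂ (ends e))

  Z-joins : Joins G e u v → Z e ≡ τ u ⊕ ⁅ e ⁆ ⊕ τ v
  Z-joins {e} {u} {v} j with joins-unique G (joins-ends G e) j
  ... | inj₁ (refl , refl) = refl
  ... | inj₂ (refl , refl) = begin
    τ v ⊕ ⁅ e ⁆ ⊕ τ u    ≡⟨ ⊕-comm _ (τ u) ⟩
    τ u ⊕ (τ v ⊕ ⁅ e ⁆)  ≡⟨ cong (τ u ⊕_) (⊕-comm (τ v) _) ⟩
    τ u ⊕ (⁅ e ⁆ ⊕ τ v)  ≡⟨ ⊕-assoc (τ u) ⁅ e ⁆ (τ v) ⟨
    τ u ⊕ ⁅ e ⁆ ⊕ τ v    ∎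
    where open ≡-Reasoning

  Z-balanced : ∀ e → Balanced G (Z e)
  Z-balanced e = boundary⇒balanced G (boundary-⊕ G
    (boundary-⊕ G (τ-boundary _) (⁅⁆-boundary G (joins-ends G e))) (boundary-sym G (τ-boundary _)))

  e∈Z : e ∉ T → e ∈ Z e
  e∈Z {e} e∉T = ∈⊕⁺ˡ (∈⊕⁺ʳ (λ e∈ → e∉T (τ⊆T _ e∈)) (x∈⁅x⁆ e)) (λ e∈ → e∉T (τ⊆T _ e∈))

  ∈Z⁻ : Joins G e u v → f ∈ Z e → f ≡ e ⊎ (f ∈ τ u × f ∉ τ v) ⊎ (f ∉ τ u × f ∈ τ v)
  ∈Z⁻ {e} {u} {v} {f} j f∈ with f ≟ e | ∈⊕⁻ (τ u ⊕ ⁅ e ⁆) (τ v) (subst (f ∈_) (Z-joins j) f∈)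
  ... | yes f≡e | _ = inj₁ f≡e
  ... | no f≢e | inj₁ (f∈ue , f∉v) with ∈⊕⁻ (τ u) ⁅ e ⁆ f∈ue
  ... | inj₁ (f∈u , _) = inj₂ (inj₁ (f∈u , f∉v))
  ... | inj₂ (_ , f∈e) = contradiction (x∈⁅y⁆⇒x≡y e f∈e) f≢e
  ∈Z⁻ {e} {u} {v} {f} j f∈ | no f≢e | inj₂ (f∉ue , f∈v) =
    inj₂ (inj₂ ((λ f∈u → f∉ue (∈⊕⁺ˡ f∈u (x≢y⇒x∉⁅y⁆ f≢e))) , f∈v))

  ∈Z⁺ˡ : e ∉ T → Joins G e u v → f ∈ τ u → f ∉ τ v → f ∈ Z e
  ∈Z⁺ˡ {u = u} e∉T j f∈u f∉v = subst (_ ∈_) (sym (Z-joins j))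
    (∈⊕⁺ˡ (∈⊕⁺ˡ f∈u (x≢y⇒x∉⁅y⁆ λ { refl → e∉T (τ⊆T u f∈u) })) f∉v)

  ∈Z⁺ʳ : e ∉ T → Joins G e u v → f ∉ τ u → f ∈ τ v → f ∈ Z e
  ∈Z⁺ʳ e∉T j f∉u f∈v = ∈Z⁺ˡ e∉T (joins-sym G j) f∈v f∉u

  Z∖T : ∀ {g} → g ∉ T → g ∈ Z e → g ≡ e
  Z∖T {e} g∉T g∈ with ∈Z⁻ (joins-ends G e) g∈
  ... | inj₁ g≡e = g≡e
  ... | inj₂ (inj₁ (g∈ , _)) = contradiction (τ⊆T _ g∈) g∉T
  ... | inj₂ (inj₂ (_ , g∈)) = contradiction (τ⊆T _ g∈) g∉T

  ≡Z : Balanced G A → e ∉ T → e ∈ A → (∀ {g} → g ∉ T → g ∈ A → g ≡ e) → A ≡ Z e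
  ≡Z {e = e} bA e∉T e∈A only = balanced-unique bA (Z-balanced e)
    (λ g∉T g∈A → subst (_∈ Z e) (sym (only g∉T g∈A)) (e∈Z e∉T))
    (λ g∉T g∈Z → subst (_∈ _) (sym (Z∖T g∉T g∈Z)) e∈A)

  cycle⊈T : IsCycle G A → (∀ {g} → g ∈ A → g ∈ T) → ∀ {ℓ} {X : Set ℓ} → X
  cycle⊈T cyc A⊆T = ⊥-elim (proj₂ (proj₁ bfs) _ cyc A⊆T)

  ∉T⇒≡⇒∈ : (∀ {g} → g ∉ T → g ∈ A → g ≡ e) → e ∉ A → ∀ {g} → g ∈ A → g ∈ T
  ∉T⇒≡⇒∈ only e∉A {g} g∈A with g ∈? T
  ... | yes g∈T = g∈T
  ... | no g∉T = contradiction (subst (_∈ _) (only g∉T g∈A) g∈A) e∉A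

  -- Some cycle lies inside `Z e`; it must use `e`, the only edge there outside the tree, and is
  -- then all of `Z e`.
  Z-cycle : e ∉ T → IsCycle G (Z e)
  Z-cycle {e} e∉T with balanced⇒∃cycle G (Z-balanced e) (e , e∈Z e∉T)
  ... | C , cyc , C⊆Z with e ∈? C
  ... | no e∉C = cycle⊈T cyc (∉T⇒≡⇒∈ (λ g∉T g∈C → Z∖T g∉T (C⊆Z g∈C)) e∉C)
  ... | yes e∈C = subst (IsCycle G) (≡Z (cycle-balanced G cyc) e∉T e∈C (λ g∉T g∈C → Z∖T g∉T (C⊆Z g∈C))) cyc

  fundamental : e ∉ T → IsCycle G A → (∀ {g} → g ∉ T → g ∈ A → g ≡ e) → IsFundamentalCycle G T A
  fundamental {e} {A} e∉T cyc only = e , e∉T , cyc , sub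
    where
    sub : A ⊆ T ∪ ⁅ e ⁆
    sub {g} g∈A with g ∈? T
    ... | yes g∈T = x∈p∪q⁺ (inj₁ g∈T)
    ... | no g∉T = x∈p∪q⁺ (inj₂ (subst (_∈ ⁅ e ⁆) (sym (only g∉T g∈A)) (x∈⁅x⁆ e)))

  Z-fundamental : e ∉ T → IsFundamentalCycle G T (Z e)
  Z-fundamental e∉T = fundamental e∉T (Z-cycle e∉T) Z∖T

  Z⊕Z-∖T : ∀ {g} → g ∉ T → g ∈ Z e ⊕ Z f → g ≡ e ⊎ g ≡ f
  Z⊕Z-∖T {e} {f} g∉T g∈ with ∈⊕⁻ (Z e) (Z f) g∈
  ... | inj₁ (g∈e , _) = inj₁ (Z∖T g∉T g∈e)
  ... | inj₂ (_ , g∈f) = inj₂ (Z∖T g∉T g∈f)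

  ≡Z⊕Z : Balanced G A → e ∉ T → f ∉ T → e ≢ f → e ∈ A → f ∈ A →
    (∀ {g} → g ∉ T → g ∈ A → g ≡ e ⊎ g ≡ f) → A ≡ Z e ⊕ Z f
  ≡Z⊕Z {A = A} {e} {f} bA e∉T f∉T e≢f e∈A f∈A only =
    balanced-unique bA (balanced-⊕ G (Z-balanced e) (Z-balanced f))
      (λ g∉T g∈A → [ (λ { refl → ∈⊕⁺ˡ (e∈Z e∉T) (λ e∈ → e≢f (Z∖T e∉T e∈)) })
                    , (λ { refl → ∈⊕⁺ʳ (λ f∈ → e≢f (sym (Z∖T f∉T f∈))) (e∈Z f∉T) }) ]′ (only g∉T g∈A))
      (λ g∉T g∈Z → [ (λ { refl → e∈A }) , (λ { refl → f∈A }) ]′ (Z⊕Z-∖T g∉T g∈Z))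

  private
    drop-one : (∀ {g} → g ∉ T → g ∈ A → g ≡ e ⊎ g ≡ f) → e ∉ A → ∀ {g} → g ∉ T → g ∈ A → g ≡ f
    drop-one only e∉A g∉T g∈A with only g∉T g∈A
    ... | inj₁ refl = contradiction g∈A e∉A
    ... | inj₂ g≡f = g≡f

    swap : (∀ {g} → g ∉ T → g ∈ A → g ≡ e ⊎ g ≡ f) → ∀ {g} → g ∉ T → g ∈ A → g ≡ f ⊎ g ≡ e
    swap only g∉T g∈A = [ inj₂ , inj₁ ]′ (only g∉T g∈A)

  -- A cycle inside the sum that used only one of the two chords would be `Z e` or `Z f`, and so
  -- contain the shared edge, which cancels in the sum. With both chords it is the whole sum.
  Z⊕Z-cycle : e ∉ T → f ∉ T → e ≢ f → Nonempty (Z e ∩ Z f) → IsCycle G (Z e ⊕ Z f)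
  Z⊕Z-cycle {e} {f} e∉T f∉T e≢f (x , x∈)
    with balanced⇒∃cycle G (balanced-⊕ G (Z-balanced e) (Z-balanced f))
           (e , ∈⊕⁺ˡ (e∈Z e∉T) (λ e∈ → e≢f (Z∖T e∉T e∈)))
  ... | C , cyc , C⊆ = by-edges (e ∈? C) (f ∈? C)
    where
    only : ∀ {g} → g ∉ T → g ∈ C → g ≡ e ⊎ g ≡ f
    only g∉T g∈C = Z⊕Z-∖T g∉T (C⊆ g∈C)
    x∉ : x ∉ Z e ⊕ Z f
    x∉ = ∉⊕ (proj₁ (x∈p∩q⁻ (Z e) (Z f) x∈)) (proj₂ (x∈p∩q⁻ (Z e) (Z f) x∈))
    by-edges : Dec (e ∈ C) → Dec (f ∈ C) → IsCycle G (Z e ⊕ Z f)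
    by-edges (yes e∈C) (yes f∈C) =
      subst (IsCycle G) (≡Z⊕Z (cycle-balanced G cyc) e∉T f∉T e≢f e∈C f∈C only) cyc
    by-edges (yes e∈C) (no f∉C) = contradiction (C⊆ (subst (x ∈_) (sym
      (≡Z (cycle-balanced G cyc) e∉T e∈C (drop-one (swap only) f∉C))) (proj₁ (x∈p∩q⁻ (Z e) (Z f) x∈)))) x∉
    by-edges (no e∉C) (yes f∈C) = contradiction (C⊆ (subst (x ∈_) (sym
      (≡Z (cycle-balanced G cyc) f∉T f∈C (drop-one only e∉C))) (proj₂ (x∈p∩q⁻ (Z e) (Z f) x∈)))) x∉
    by-edges (no e∉C) (no f∉C) = cycle⊈T cyc (∉T⇒≡⇒∈ (drop-one only e∉C) f∉C)

  -- A cycle is the sum of the fundamental cycles of its chords. Here `e` and `f` may coincide, lie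
  -- in `T` or miss `C`, which makes up the cases.
  two-chords : ∀ {C} → IsCycle G C → (∀ {g} → g ∉ T → g ∈ C → g ≡ e ⊎ g ≡ f) →
    IsFundamentalCycle G T C ⊎
    (∃[ A ] ∃[ B ] (IsFundamentalCycle G T A × IsFundamentalCycle G T B × C ≡ A ⊕ B))
  two-chords {e} {f} {C} cyc only with chord? e | chord? f | e ≟ f
    where
    chord? : ∀ g → Dec (g ∉ T × g ∈ C)
    chord? g = ¬? (g ∈? T) ×-dec (g ∈? C)
  ... | yes (e∉T , e∈C) | yes (f∉T , f∈C) | no e≢f = inj₂ (Z e , Z f , Z-fundamental e∉T , Z-fundamental f∉T ,
        ≡Z⊕Z (cycle-balanced G cyc) e∉T f∉T e≢f e∈C f∈C only)
  ... | yes (e∉T , _) | yes _ | yes refl = inj₁ (fundamental e∉T cyc (λ g∉T g∈C → [ (λ eq → eq) , (λ eq → eq) ]′ (only g∉T g∈C)))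
  ... | yes (e∉T , _) | no f≁ | _ = inj₁ (fundamental e∉T cyc λ g∉T g∈C →
        [ (λ eq → eq) , (λ { refl → contradiction (g∉T , g∈C) f≁ }) ]′ (only g∉T g∈C))
  ... | no e≁ | yes (f∉T , _) | _ = inj₁ (fundamental f∉T cyc λ g∉T g∈C →
        [ (λ { refl → contradiction (g∉T , g∈C) e≁ }) , (λ eq → eq) ]′ (only g∉T g∈C))
  ... | no e≁ | no f≁ | _ = cycle⊈T cyc ⊆T
    where
    ⊆T : ∀ {g} → g ∈ C → g ∈ T
    ⊆T {g} g∈C with g ∈? T
    ... | yes g∈T = g∈T
    ... | no g∉T = [ (λ { refl → contradiction (g∉T , g∈C) e≁ }) , (λ { refl → contradiction (g∉T , g∈C) f≁ }) ]′ (only g∉T g∈C)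

-- Cycles as cyclic sequences

-- Only the values vertex i with i ≤ period and edge i with i < period are meaningful.
record Tour {n m : ℕ} (G : Graph n m) (C : Subset m) : Set where
  field
    period      : ℕ
    vertex      : ℕ → Fin n
    edge        : ℕ → Fin m
    closed      : vertex period ≡ vertex 0
    joins       : ∀ {i} → i < period → Joins G (edge i) (vertex i) (vertex (suc i))
    edge∈       : ∀ {i} → i < period → edge i ∈ C
    covers      : ∀ {e} → e ∈ C → ∃[ i ] (i < period × edge i ≡ e)
    injective   : ∀ {i j} → i < period → j < period → edge i ≡ edge j → i ≡ j
    period≡size : period ≡ ∣ C ∣

module _ {n m : ℕ} (G : Graph n m) where

  private
    variable
      u v : Fin n

  vertexAt : Walk G u v → ℕ → Fin n
  vertexAt {v = v} []           _       = v
  vertexAt {u}     (step _ _ p) zero    = u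
  vertexAt         (step _ _ p) (suc i) = vertexAt p i

  edgeAt : Fin m → Walk G u v → ℕ → Fin m
  edgeAt e₀ []           _       = e₀
  edgeAt e₀ (step e _ p) zero    = e
  edgeAt e₀ (step e _ p) (suc i) = edgeAt e₀ p i

  vertexAt-zero : (p : Walk G u v) → vertexAt p 0 ≡ u
  vertexAt-zero []           = refl
  vertexAt-zero (step _ _ p) = refl

  vertexAt-length : (p : Walk G u v) → vertexAt p (length G p) ≡ v
  vertexAt-length []           = refl
  vertexAt-length (step _ _ p) = vertexAt-length p

  edgeAt-joins : ∀ e₀ (p : Walk G u v) {i} → i < length G p →
    Joins G (edgeAt e₀ p i) (vertexAt p i) (vertexAt p (suc i))
  edgeAt-joins e₀ (step e j p) {zero}  _         = subst (Joins G e _) (sym (vertexAt-zero p)) j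
  edgeAt-joins e₀ (step e j p) {suc i} (s≤s i<) = edgeAt-joins e₀ p i<

  edgeAt∈ : ∀ e₀ (p : Walk G u v) {i} → i < length G p → edgeAt e₀ p i ∈ₗ edges G p
  edgeAt∈ e₀ (step e j p) {zero}  _         = here refl
  edgeAt∈ e₀ (step e j p) {suc i} (s≤s i<) = there (edgeAt∈ e₀ p i<)

  edgeAt-covers : ∀ e₀ (p : Walk G u v) {e} → e ∈ₗ edges G p → ∃[ i ] (i < length G p × edgeAt e₀ p i ≡ e)
  edgeAt-covers e₀ (step e j p) (here refl) = 0 , s≤s z≤n , refl
  edgeAt-covers e₀ (step e j p) (there e∈) with edgeAt-covers e₀ p e∈
  ... | i , i< , eq = suc i , s≤s i< , eq

  edgeAt-injective : ∀ e₀ (p : Walk G u v) → Unique (edges G p) → ∀ {i j} →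
    i < length G p → j < length G p → edgeAt e₀ p i ≡ edgeAt e₀ p j → i ≡ j
  edgeAt-injective e₀ (step e _ p) (e∉ ∷ π) {zero}  {zero}  _ _ eq = refl
  edgeAt-injective e₀ (step e _ p) (e∉ ∷ π) {zero}  {suc j} _ (s≤s j<) eq = contradiction eq (All.lookup e∉ (edgeAt∈ e₀ p j<))
  edgeAt-injective e₀ (step e _ p) (e∉ ∷ π) {suc i} {zero}  (s≤s i<) _ eq = contradiction (sym eq) (All.lookup e∉ (edgeAt∈ e₀ p i<))
  edgeAt-injective e₀ (step e _ p) (e∉ ∷ π) {suc i} {suc j} (s≤s i<) (s≤s j<) eq = cong suc (edgeAt-injective e₀ p π i< j< eq)

  tour : ∀ {C} → IsCycle G C → Tour G C
  tour (v , [] , ≢[] , _) = contradiction refl ≢[]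
  tour (v , p@(step e _ q) , _ , _ , π , refl) = record
    { period      = length G p
    ; vertex      = vertexAt p
    ; edge        = edgeAt e p
    ; closed      = vertexAt-length q
    ; joins       = edgeAt-joins e p
    ; edge∈       = λ i< → ∈edgeSet⁺ G p (edgeAt∈ e p i<)
    ; covers      = λ x∈ → edgeAt-covers e p (∈edgeSet⁻ G p x∈)
    ; injective   = edgeAt-injective e p π
    ; period≡size = sym (∣edgeSet∣ G p π)
    }

-- A cycle seen from a tree rooted at one of its vertices

module RootedTour {n m : ℕ} (G : Graph n m) {C : Subset m} (cyc : IsCycle G C) (t : Tour G C)
  {T : Subset m} (bfs : IsBFSTree G (Tour.vertex t 0) T) where

  open Tour t renaming (period to ℓ; vertex to c; edge to ε)
  open Rooted G bfs

  by-index : ∀ (P : Fin m → Set) → (∀ {i} → i < ℓ → P (ε i)) → ∀ {g} → g ∈ C → P g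
  by-index P Pε g∈C with covers g∈C
  ... | i , i<ℓ , eq = subst P eq (Pε i<ℓ)

  d : ℕ → ℕ
  d i = dist (c i)

  d≤-prefix : ∀ i → i ≤ ℓ → d i ≤ i
  d≤-prefix zero    _  = ℕ.≤-reflexive dist-root
  d≤-prefix (suc i) i< = ℕ.≤-trans (dist-lipschitz (joins i<)) (s≤s (d≤-prefix i (ℕ.<⇒≤ i<)))

  d-forward : ∀ s i → i + s ≤ ℓ → d (i + s) ≤ d i + s
  d-forward zero i _ = ℕ.≤-reflexive (trans (cong d (ℕ.+-identityʳ i)) (sym (ℕ.+-identityʳ (d i))))
  d-forward (suc s) i i+s≤ rewrite ℕ.+-suc i s | ℕ.+-suc (d i) s =
    ℕ.≤-trans (dist-lipschitz (joins i+s≤)) (s≤s (d-forward s i (ℕ.<⇒≤ i+s≤)))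

  d-backward : ∀ s i → i + s ≤ ℓ → d i ≤ d (i + s) + s
  d-backward zero i _ = ℕ.≤-reflexive (trans (sym (cong d (ℕ.+-identityʳ i))) (sym (ℕ.+-identityʳ _)))
  d-backward (suc s) i i+s≤ rewrite ℕ.+-suc i s | ℕ.+-suc (d (suc (i + s))) s =
    ℕ.≤-trans (d-backward s i (ℕ.<⇒≤ i+s≤)) (ℕ.+-monoˡ-≤ s (dist-lipschitz (joins-sym G (joins i+s≤))))

  d-end : d ℓ ≡ 0
  d-end = trans (cong dist closed) dist-root

  d≤-suffix : ∀ i r → i + r ≡ ℓ → d i ≤ r
  d≤-suffix i r eq = begin
    d i            ≤⟨ d-backward r i (ℕ.≤-reflexive eq) ⟩
    d (i + r) + r  ≡⟨ cong (λ k → d k + r) eq ⟩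
    d ℓ + r        ≡⟨ cong (_+ r) d-end ⟩
    r              ∎
    where open ℕ.≤-Reasoning

  -- A shortcut to `c h`, continued along the cycle, would be a shortcut to `c p`.
  d-tight-prefix : ∀ {h p} → h ≤ p → p ≤ ℓ → d p ≡ p → d h ≡ h
  d-tight-prefix {h} h≤p p≤ℓ eq with ℕ.m≤n⇒∃[o]m+o≡n h≤p
  ... | s , refl = ℕ.≤-antisym (d≤-prefix h (ℕ.≤-trans h≤p p≤ℓ))
    (ℕ.+-cancelʳ-≤ s h (d h) (subst (_≤ d h + s) eq (d-forward s h p≤ℓ)))

  d-tight-suffix : ∀ {h p q r} → p ≤ h → p + q ≡ ℓ → h + r ≡ ℓ → d p ≡ q → d h ≡ r
  d-tight-suffix {h} {p} {q} {r} p≤h p+q≡ℓ h+r≡ℓ eq with ℕ.m≤n⇒∃[o]m+o≡n p≤h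
  ... | s , refl = ℕ.≤-antisym (d≤-suffix h r h+r≡ℓ) (ℕ.+-cancelˡ-≤ s r _ (begin
      s + r    ≡⟨ ℕ.+-cancelˡ-≡ p _ _ (trans (sym (ℕ.+-assoc p s r)) (trans h+r≡ℓ (sym p+q≡ℓ))) ⟩
      q        ≡⟨ eq ⟨
      d p      ≤⟨ d-backward s p (subst (h ≤_) h+r≡ℓ (ℕ.m≤m+n h r)) ⟩
      d h + s  ≡⟨ ℕ.+-comm _ s ⟩
      s + d h  ∎))
    where open ℕ.≤-Reasoning

  ∣Z∣≤ : ∀ {i} → i < ℓ → ∣ Z (ε i) ∣ ≤ d i + suc (d (suc i))
  ∣Z∣≤ {i} i< = begin
    ∣ Z (ε i) ∣                                   ≡⟨ cong ∣_∣ (trans (Z-joins (joins i<)) (⊕-assoc (τ (c i)) ⁅ ε i ⁆ _)) ⟩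
    ∣ τ (c i) ⊕ (⁅ ε i ⁆ ⊕ τ (c (suc i))) ∣       ≤⟨ ∣⊕∣≤ (τ (c i)) _ ⟩
    d i + ∣ ⁅ ε i ⁆ ⊕ τ (c (suc i)) ∣             ≤⟨ ℕ.+-monoʳ-≤ (d i) (∣⊕∣≤ ⁅ ε i ⁆ _) ⟩
    d i + (∣ ⁅ ε i ⁆ ∣ + d (suc i))               ≡⟨ cong (λ k → d i + (k + d (suc i))) (∣⁅x⁆∣≡1 (ε i)) ⟩
    d i + suc (d (suc i))                         ∎
    where open ℕ.≤-Reasoning

  -- Cancellation between the two root paths removes edges in pairs, so parities simply add.
  odd∣Z∣ : ∀ {i} → i < ℓ → odd ∣ Z (ε i) ∣ ≡ odd (d i) xor not (odd (d (suc i)))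
  odd∣Z∣ {i} i< = begin
    odd ∣ Z (ε i) ∣                                        ≡⟨ ∙⊤ (Z (ε i)) ⟨
    Z (ε i) ∙ ⊤                                            ≡⟨ cong (_∙ ⊤) (trans (Z-joins (joins i<)) (⊕-assoc (τ (c i)) ⁅ ε i ⁆ _)) ⟩
    (τ (c i) ⊕ (⁅ ε i ⁆ ⊕ τ (c (suc i)))) ∙ ⊤              ≡⟨ ∙-distribʳ-⊕ ⊤ (τ (c i)) _ ⟩
    τ (c i) ∙ ⊤ xor (⁅ ε i ⁆ ⊕ τ (c (suc i))) ∙ ⊤          ≡⟨ cong₂ _xor_ (∙⊤ (τ (c i))) (∙-distribʳ-⊕ ⊤ ⁅ ε i ⁆ _) ⟩
    odd (d i) xor (⁅ ε i ⁆ ∙ ⊤ xor τ (c (suc i)) ∙ ⊤)      ≡⟨ cong (odd (d i) xor_) (cong₂ _xor_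
                                                               (trans (∙⊤ ⁅ ε i ⁆) (cong odd (∣⁅x⁆∣≡1 (ε i)))) (∙⊤ (τ (c (suc i))))) ⟩
    odd (d i) xor not (odd (d (suc i)))                    ∎
    where open ≡-Reasoning

  even-ascent : ∀ {i} → i < ℓ → d (suc i) ≡ suc (d i) → odd ∣ Z (ε i) ∣ ≡ false
  even-ascent {i} i< eq = trans (odd∣Z∣ i<) (trans (cong (λ k → odd (d i) xor not (odd k)) eq)
    (trans (cong (odd (d i) xor_) (not-involutive _)) (xor-same (odd (d i)))))

  even-descent : ∀ {i} → i < ℓ → d i ≡ suc (d (suc i)) → odd ∣ Z (ε i) ∣ ≡ false
  even-descent {i} i< eq = trans (odd∣Z∣ i<) (trans (cong (λ k → odd k xor not (odd (d (suc i)))) eq)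
    (xor-same (not (odd (d (suc i))))))

  -- Along tree edges of the cycle the root path changes only by edges of `C`, so membership of an
  -- edge off `C` stays constant.
  τ-off-C : ∀ {f i} → f ∉ C → ∀ j → i ≤ j → j ≤ ℓ → (∀ {k} → i ≤ k → k < j → ε k ∈ T) →
    lookup (τ (c i)) f ≡ lookup (τ (c j)) f
  τ-off-C {f} {i} f∉C j i≤j j≤ℓ inT with ℕ.m≤n⇒m<n∨m≡n i≤j
  τ-off-C f∉C j i≤j j≤ℓ inT | inj₂ refl = refl
  τ-off-C {f} {i} f∉C (suc j) i≤j j<ℓ inT | inj₁ (s≤s i≤j′) = begin
    lookup (τ (c i)) f                             ≡⟨ τ-off-C f∉C j i≤j′ (ℕ.<⇒≤ j<ℓ) (λ i≤k k<j → inT i≤k (ℕ.m≤n⇒m≤1+n k<j)) ⟩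
    lookup (τ (c j)) f                             ≡⟨ xor-identityʳ _ ⟨
    lookup (τ (c j)) f xor false                   ≡⟨ cong (lookup (τ (c j)) f xor_) (∉⇒lookup f∉ε) ⟨
    lookup (τ (c j)) f xor lookup ⁅ ε j ⁆ f        ≡⟨ lookup-⊕ (τ (c j)) ⁅ ε j ⁆ f ⟨
    lookup (τ (c j) ⊕ ⁅ ε j ⁆) f                   ≡⟨ cong (λ A → lookup A f) (τ-step (inT i≤j′ ℕ.≤-refl) (joins j<ℓ)) ⟨
    lookup (τ (c (suc j))) f                       ∎
    where
    open ≡-Reasoning
    f∉ε : f ∉ ⁅ ε j ⁆
    f∉ε f∈ = f∉C (subst (_∈ C) (sym (x∈⁅y⁆⇒x≡y (ε j) f∈)) (edge∈ j<ℓ))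

  module _ {f i j} (f∉C : f ∉ C) (i≤j : i ≤ j) (j≤ℓ : j ≤ ℓ) (inT : ∀ {k} → i ≤ k → k < j → ε k ∈ T) where

    τ-forward : f ∈ τ (c i) → f ∈ τ (c j)
    τ-forward f∈ = lookup⇒[]= f _ (trans (sym (τ-off-C f∉C j i≤j j≤ℓ inT)) ([]=⇒lookup f∈))

    τ-backward : f ∈ τ (c j) → f ∈ τ (c i)
    τ-backward f∈ = lookup⇒[]= f _ (trans (τ-off-C f∉C j i≤j j≤ℓ inT) ([]=⇒lookup f∈))

  ∉τ-start : ∀ {f} → f ∉ τ (c 0)
  ∉τ-start f∈ = ∉⊥ (subst (_ ∈_) τ-root f∈)

  ∉τ-end : ∀ {f} → f ∉ τ (c ℓ)
  ∉τ-end f∈ = ∉τ-start (subst (λ v → _ ∈ τ v) closed f∈)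

  -- A chord is an edge of the cycle outside T.  The two chords are consecutive along the cycle.
  record SharingPair : Set where
    field
      {i j}   : ℕ
      i<j     : i < j
      j<ℓ     : j < ℓ
      εi∉T    : ε i ∉ T
      εj∉T    : ε j ∉ T
      between : ∀ {k} → i < k → k < j → ε k ∈ T
      shared  : Nonempty (Z (ε i) ∩ Z (ε j))

    i<ℓ : i < ℓ
    i<ℓ = ℕ.<-trans i<j j<ℓ

    εi≢εj : ε i ≢ ε j
    εi≢εj eq = ℕ.<⇒≢ i<j (injective i<ℓ j<ℓ eq)

  -- By cycle-minimal, C is then itself the fundamental cycle of one of its chords.
  Inside : Set
  Inside = ∃[ i ] (i < ℓ × ε i ∉ T × Z (ε i) ⊆ C)

  -- Progress after the first j edges.  The invariant in the last constructor, that the part of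
  -- Z (ε i) hanging from the near end of the last chord lies in C, can only be lost at the next
  -- chord; if that chord shares no edge with ε i, then losing it forces Z (ε i) ⊆ C.
  data State (j : ℕ) : Set where
    inside  : Inside → State j
    sharing : SharingPair → State j
    inTree  : (∀ {k} → k < j → ε k ∈ T) → State j
    last    : ∀ i → i < j → ε i ∉ T → (∀ {k} → i < k → k < j → ε k ∈ T) →
              (∀ {a} → a ∈ τ (c i) → a ∉ τ (c (suc i)) → a ∈ C) → State j

  private
    extend-∀ : ∀ {j} {P Q : ℕ → Set} → (∀ {k} → P k → k < j → Q k) → Q j → ∀ {k} → P k → k < suc j → Q k
    extend-∀ below at Pk (s≤s k≤j) with ℕ.m≤n⇒m<n∨m≡n k≤j
    ... | inj₁ k<j  = below Pk k<j
    ... | inj₂ refl = at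

  advance : ∀ {j} → j < ℓ → State j → State (suc j)
  advance j<ℓ (inside r)  = inside r
  advance j<ℓ (sharing r) = sharing r
  advance {j} j<ℓ (inTree inT) with ε j ∈? T
  -- `inTree` has no lower bound on the index, so `P` is a dummy condition witnessed by `0`.
  ... | yes εj∈T = inTree (extend-∀ {P = λ _ → ℕ} (λ _ → inT) εj∈T 0)
  ... | no εj∉T = last j ℕ.≤-refl εj∉T (λ { j<k (s≤s k≤j) → contradiction k≤j (ℕ.<⇒≱ j<k) }) left
    where
    left : ∀ {a} → a ∈ τ (c j) → a ∉ τ (c (suc j)) → a ∈ C
    left {a} a∈ _ with a ∈? C
    ... | yes a∈C = a∈C
    ... | no a∉C = contradiction (τ-backward a∉C z≤n (ℕ.<⇒≤ j<ℓ) (λ _ → inT) a∈) ∉τ-start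
  advance {j} j<ℓ (last i i<j εi∉T inT left) with ε j ∈? T
  ... | yes εj∈T = last i (ℕ.m≤n⇒m≤1+n i<j) εi∉T (extend-∀ {P = i <_} inT εj∈T) left
  ... | no εj∉T with nonempty? (Z (ε i) ∩ Z (ε j))
  ... | yes shared = sharing record
        { i<j = i<j ; j<ℓ = j<ℓ ; εi∉T = εi∉T ; εj∉T = εj∉T ; between = inT ; shared = shared }
  -- Look for an edge `a` that breaks the invariant at the new chord.
  ... | no disjoint with any? (λ a → (a ∈? τ (c j)) ×-dec ¬? (a ∈? τ (c (suc j))) ×-dec ¬? (a ∈? C))
  ... | no ¬a = last j ℕ.≤-refl εj∉T (λ { j<k (s≤s k≤j) → contradiction k≤j (ℕ.<⇒≱ j<k) }) left′
    where
    left′ : ∀ {a} → a ∈ τ (c j) → a ∉ τ (c (suc j)) → a ∈ C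
    left′ {a} a∈ a∉ with a ∈? C
    ... | yes a∈C = a∈C
    ... | no a∉C = contradiction (a , a∈ , a∉ , a∉C) ¬a
  ... | yes (a , a∈j , a∉j′ , a∉C) = inside (i , i<ℓ , εi∉T , Z⊆C)
    where
    i<ℓ : i < ℓ
    i<ℓ = ℕ.<-trans i<j j<ℓ
    a∈i′ : a ∈ τ (c (suc i))
    a∈i′ = τ-backward a∉C i<j (ℕ.<⇒≤ j<ℓ) inT a∈j
    -- Otherwise `a` would be shared by the two fundamental cycles. So `a` lies on the common part
    -- of the root paths to both ends of `ε i`.
    a∈i : a ∈ τ (c i)
    a∈i with a ∈? τ (c i)
    ... | yes a∈ = a∈
    ... | no a∉ = contradiction (a , x∈p∩q⁺ (∈Z⁺ʳ εi∉T (joins i<ℓ) a∉ a∈i′ , ∈Z⁺ˡ εj∉T (joins j<ℓ) a∈j a∉j′)) disjoint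
    right : ∀ {b} → b ∈ Z (ε i) → b ∉ τ (c i) → b ∈ τ (c (suc i)) → b ∈ C
    right {b} b∈Z b∉i b∈i′ with b ∈? C | b ∈? τ (c (suc j))
    ... | yes b∈C | _ = b∈C
    ... | no b∉C | no b∉j′ = contradiction
          (b , x∈p∩q⁺ (b∈Z , ∈Z⁺ˡ εj∉T (joins j<ℓ) (τ-forward b∉C i<j (ℕ.<⇒≤ j<ℓ) inT b∈i′) b∉j′)) disjoint
    -- The root path to `c (suc j)` contains `b` but not `a`, the one to `c i` contains `a` but not
    -- `b`; so neither edge can come first on the root path to `c (suc i)`.
    ... | no b∉C | yes b∈j′ with τ-laminar a∈i′ b∈i′
    ... | inj₁ b⇒a = contradiction (b⇒a _ b∈j′) a∉j′
    ... | inj₂ a⇒b = contradiction (a⇒b _ a∈i) b∉i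
    Z⊆C : Z (ε i) ⊆ C
    Z⊆C b∈Z with ∈Z⁻ (joins i<ℓ) b∈Z
    ... | inj₁ refl = edge∈ i<ℓ
    ... | inj₂ (inj₁ (b∈i , b∉i′)) = left b∈i b∉i′
    ... | inj₂ (inj₂ (b∉i , b∈i′)) = right b∈Z b∉i b∈i′

  state : ∀ j → j ≤ ℓ → State j
  state zero    _  = inTree λ ()
  state (suc j) j< = advance j< (state j (ℕ.<⇒≤ j<))

  inside⊎sharing : Inside ⊎ SharingPair
  inside⊎sharing with state ℓ ℕ.≤-refl
  ... | inside r  = inj₁ r
  ... | sharing r = inj₂ r
  ... | inTree inT = cycle⊈T cyc (by-index (_∈ T) inT)
  ... | last i i<ℓ εi∉T inT left = inj₁ (i , i<ℓ , εi∉T , Z⊆C)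
    where
    right : ∀ {b} → b ∈ τ (c (suc i)) → b ∈ C
    right {b} b∈ with b ∈? C
    ... | yes b∈C = b∈C
    -- The arc after the last chord consists of tree edges and leads back to the root, whose root
    -- path is empty.
    ... | no b∉C = contradiction (τ-forward b∉C i<ℓ ℕ.≤-refl inT b∈) ∉τ-end
    Z⊆C : Z (ε i) ⊆ C
    Z⊆C b∈Z with ∈Z⁻ (joins i<ℓ) b∈Z
    ... | inj₁ refl = edge∈ i<ℓ
    ... | inj₂ (inj₁ (b∈i , b∉i′)) = left b∈i b∉i′
    ... | inj₂ (inj₂ (b∉i , b∈i′)) = right b∈i′

  inside⇒≡ : ∀ {e} → e ∉ T → Z e ⊆ C → Z e ≡ C
  inside⇒≡ e∉T Z⊆C = cycle-minimal G cyc (Z-balanced _) (_ , e∈Z e∉T) Z⊆C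

  -- `M` is the mod-2 sum of the `s` edges of the segment.
  τ-segment : ∀ s i → i + s ≤ ℓ → (∀ {k} → i ≤ k → k < i + s → ε k ∈ T) →
    ∃[ M ] (τ (c (i + s)) ≡ τ (c i) ⊕ M × ∣ M ∣ ≤ s)
  τ-segment zero i _ _ = ⊥ , trans (cong (τ ∘ c) (ℕ.+-identityʳ i)) (sym (trans (⊕-comm _ ⊥) (⊕-identityˡ _))) ,
    ℕ.≤-reflexive (∣⊥∣≡0 m)
  τ-segment (suc s) i i+s< inT rewrite ℕ.+-suc i s with τ-segment s i (ℕ.<⇒≤ i+s<) (λ i≤k k< → inT i≤k (ℕ.m≤n⇒m≤1+n k<))
  ... | M , eq , ∣M∣≤ = M ⊕ ⁅ ε (i + s) ⁆ ,
    trans (τ-step (inT (ℕ.m≤m+n i s) ℕ.≤-refl) (joins i+s<)) (trans (cong (_⊕ _) eq) (⊕-assoc (τ (c i)) M _)) ,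
    (begin
      ∣ M ⊕ ⁅ ε (i + s) ⁆ ∣       ≤⟨ ∣⊕∣≤ M _ ⟩
      ∣ M ∣ + ∣ ⁅ ε (i + s) ⁆ ∣   ≡⟨ cong (∣ M ∣ +_) (∣⁅x⁆∣≡1 (ε (i + s))) ⟩
      ∣ M ∣ + 1                   ≤⟨ ℕ.+-monoˡ-≤ 1 ∣M∣≤ ⟩
      s + 1                       ≡⟨ ℕ.+-comm s 1 ⟩
      suc s                       ∎)
    where open ℕ.≤-Reasoning

  -- The part of the cycle between two consecutive chords cancels against the tree paths.
  ∣Z⊕Z∣≤ : ∀ i s → let j = suc i + s in j < ℓ → (∀ {k} → i < k → k < j → ε k ∈ T) →
    ∣ Z (ε i) ⊕ Z (ε j) ∣ ≤ suc (d i) + (suc s + d (suc j))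
  ∣Z⊕Z∣≤ i s j<ℓ inT with τ-segment s (suc i) (ℕ.<⇒≤ j<ℓ) inT
  ... | M , eq , ∣M∣≤ = begin
    ∣ Z (ε i) ⊕ Z (ε j) ∣                                   ≡⟨ cong ∣_∣ cancel ⟩
    ∣ X ⊕ (M ⊕ ⁅ ε j ⁆ ⊕ W) ∣                               ≤⟨ ∣⊕∣≤ X _ ⟩
    ∣ X ∣ + ∣ M ⊕ ⁅ ε j ⁆ ⊕ W ∣                             ≤⟨ ℕ.+-mono-≤ (∣⊕∣≤ (τ (c i)) ⁅ ε i ⁆) (∣⊕∣≤ (M ⊕ ⁅ ε j ⁆) W) ⟩
    (d i + ∣ ⁅ ε i ⁆ ∣) + (∣ M ⊕ ⁅ ε j ⁆ ∣ + ∣ W ∣)         ≤⟨ ℕ.+-monoʳ-≤ (d i + _) (ℕ.+-monoˡ-≤ ∣ W ∣ (∣⊕∣≤ M ⁅ ε j ⁆)) ⟩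
    (d i + ∣ ⁅ ε i ⁆ ∣) + ((∣ M ∣ + ∣ ⁅ ε j ⁆ ∣) + ∣ W ∣)   ≡⟨ cong₂ (λ p q → (d i + p) + ((∣ M ∣ + q) + ∣ W ∣)) (∣⁅x⁆∣≡1 (ε i)) (∣⁅x⁆∣≡1 (ε j)) ⟩
    (d i + 1) + ((∣ M ∣ + 1) + ∣ W ∣)                       ≡⟨ cong₂ (λ p q → p + (q + ∣ W ∣)) (ℕ.+-comm (d i) 1) (ℕ.+-comm ∣ M ∣ 1) ⟩
    suc (d i) + (suc ∣ M ∣ + ∣ W ∣)                         ≤⟨ ℕ.+-monoʳ-≤ (suc (d i)) (ℕ.+-monoˡ-≤ ∣ W ∣ (s≤s ∣M∣≤)) ⟩
    suc (d i) + (suc s + ∣ W ∣)                             ∎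
    where
    open ℕ.≤-Reasoning
    j = suc i + s
    X = τ (c i) ⊕ ⁅ ε i ⁆
    Y = τ (c (suc i))
    W = τ (c (suc j))
    cancel : Z (ε i) ⊕ Z (ε j) ≡ X ⊕ (M ⊕ ⁅ ε j ⁆ ⊕ W)
    cancel = trans
      (cong₂ _⊕_ (Z-joins (joins (ℕ.<-trans (s≤s (ℕ.m≤m+n i s)) j<ℓ))) (Z-joins (joins j<ℓ)))
      (trans (cong (λ A → (X ⊕ Y) ⊕ (A ⊕ ⁅ ε j ⁆ ⊕ W)) eq) (⊕-cancel-middle X Y M ⁅ ε j ⁆ W))

-- Arithmetic of tight bounds

+-tight : ∀ {a b i r} → a ≤ i → b ≤ r → i + r ≤ a + b → a ≡ i × b ≡ r
+-tight {a} {b} {i} {r} a≤i b≤r le =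
  ℕ.≤-antisym a≤i (ℕ.+-cancelʳ-≤ r i a (ℕ.≤-trans le (ℕ.+-monoʳ-≤ a b≤r))) ,
  ℕ.≤-antisym b≤r (ℕ.+-cancelˡ-≤ i r b (ℕ.≤-trans le (ℕ.+-monoˡ-≤ b a≤i)))

double-injective : ∀ {i j} → i + i ≡ j + j → i ≡ j
double-injective {i} {j} eq with ℕ.<-cmp i j
... | tri< i<j _ _ = contradiction eq (ℕ.<⇒≢ (ℕ.+-mono-< i<j i<j))
... | tri≈ _ i≡j _ = i≡j
... | tri> _ _ i>j = contradiction (sym eq) (ℕ.<⇒≢ (ℕ.+-mono-< i>j i>j))

-- `i` and `r` are the lengths of the arcs from the two ends of an edge to the root. Their sum is
-- odd, so they differ by exactly one.
central : ∀ {i r k} → suc i + r ≡ k + k → i ≤ suc r → r ≤ suc i → i ≡ k ⊎ suc i ≡ k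
central {i} {r} {k} eq i≤ r≤ with ℕ.<-cmp i k
... | tri≈ _ i≡k _ = inj₁ i≡k
... | tri> _ _ k<i = contradiction (sym eq)
      (ℕ.<⇒≢ (subst (k + k <_) (ℕ.+-suc i r) (ℕ.+-mono-< k<i (ℕ.<-≤-trans k<i i≤))))
... | tri< i<k _ _ with ℕ.m≤n⇒m<n∨m≡n i<k
... | inj₂ eq′ = inj₂ eq′
... | inj₁ 1+i<k = contradiction eq (ℕ.<⇒≢ (ℕ.+-mono-< 1+i<k (ℕ.≤-<-trans r≤ 1+i<k)))

minimal-subset : ∀ {m} {P : Subset m → Set} → (∀ D → Dec (P D)) → ∃ P → ∃ (IsMinimum P)
minimal-subset {P = P} P? (D , PD) = search ∣ D ∣ D PD ℕ.≤-refl
  where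
  search : ∀ k D → P D → ∣ D ∣ ≤ k → ∃ (IsMinimum P)
  search k D PD D≤k with anySubset? (λ E → P? E ×-dec (∣ E ∣ ℕ.<? ∣ D ∣))
  search k D PD D≤k | no none = D , PD , λ E PE → ℕ.≮⇒≥ λ E<D → none (E , PE , E<D)
  search zero D PD D≤k | yes (E , PE , E<D) = contradiction (ℕ.<-≤-trans E<D D≤k) λ ()
  search (suc k) D PD D≤k | yes (E , PE , E<D) = search k E PE (ℕ.≤-pred (ℕ.<-≤-trans E<D D≤k))

-- Short cycles made of one or two fundamental cycles

module Candidates {n m : ℕ} (G : Graph n m) {z : Fin n} {T : Subset m} (bfs : IsBFSTree G z T) where
  open Rooted G bfs

  -- Decidable by search over the chords, so that a shortest two-sided candidate can be selected
  -- constructively.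
  Candidate : Subset m → Set
  Candidate D = ∃[ e ] ∃[ f ] (e ∉ T × f ∉ T ×
    (D ≡ Z e ⊎ (e ≢ f × Nonempty (Z e ∩ Z f) × D ≡ Z e ⊕ Z f)))

  candidate? : ∀ D → Dec (Candidate D)
  candidate? D = any? λ e → any? λ f → ¬? (e ∈? T) ×-dec ¬? (f ∈? T) ×-dec
    (≡-dec Bool._≟_ D (Z e) ⊎-dec (¬? (e ≟ f) ×-dec nonempty? (Z e ∩ Z f) ×-dec ≡-dec Bool._≟_ D (Z e ⊕ Z f)))

  candidate-cycle : ∀ {D} → Candidate D → IsCycle G D
  candidate-cycle (e , f , e∉T , f∉T , inj₁ refl) = Z-cycle e∉T
  candidate-cycle (e , f , e∉T , f∉T , inj₂ (e≢f , shared , refl)) = Z⊕Z-cycle e∉T f∉T e≢f shared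

module ShortCandidate {n m : ℕ} (G : Graph n m) {C : Subset m} (cyc : IsCycle G C) (t : Tour G C)
  {T : Subset m} (bfs : IsBFSTree G (Tour.vertex t 0) T) where

  open Tour t renaming (period to ℓ; vertex to c; edge to ε)
  open Rooted G bfs
  open Candidates G bfs
  open RootedTour G cyc t bfs
  open ℕ.≤-Reasoning

  sharing-bound : (p : SharingPair) → let open SharingPair p in
    ∃[ s ] ∃[ r ] (suc j + r ≡ ℓ × suc i + (suc s + r) ≡ ℓ ×
      ∣ Z (ε i) ⊕ Z (ε j) ∣ ≤ suc (d i) + (suc s + d (suc j)))
  -- Abstracting the fields makes `j` a variable that `refl` can replace by `suc i + s`. There are
  -- `s` edges between the chords and `r` after the second.
  sharing-bound p with SharingPair.i p | SharingPair.j p | SharingPair.i<j p | SharingPair.j<ℓ p | (λ {k} → SharingPair.between p {k})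
  ... | i | j | i<j | j<ℓ | between with ℕ.m≤n⇒∃[o]m+o≡n i<j | ℕ.m≤n⇒∃[o]m+o≡n j<ℓ
  ... | s , refl | r , eq = s , r , eq , trans (trans (ℕ.+-suc (suc i) (s + r)) (cong suc (sym (ℕ.+-assoc (suc i) s r)))) eq ,
    ∣Z⊕Z∣≤ i s j<ℓ between

  -- Root paths are no longer than arcs of `C`, which bounds both kinds of candidates. If no chord
  -- has an even fundamental cycle with respect to `N`, two odd ones add up to an even one.
  short-candidate : ∀ N → C ∙ N ≡ false → ∃[ D ] (Candidate D × D ∙ N ≡ false × ∣ D ∣ ≤ ∣ C ∣)
  short-candidate N even with any? (λ e → (e ∈? C) ×-dec ¬? (e ∈? T) ×-dec (Z e ∙ N Bool.≟ false))
  ... | yes (e , e∈C , e∉T , Z-even) with covers e∈C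
  ... | i , i<ℓ , refl = Z (ε i) , (ε i , ε i , e∉T , e∉T , inj₁ refl) , Z-even , bound
    where
    bound : ∣ Z (ε i) ∣ ≤ ∣ C ∣
    bound with ℕ.m≤n⇒∃[o]m+o≡n i<ℓ
    ... | r , eq = begin
      ∣ Z (ε i) ∣              ≤⟨ ∣Z∣≤ i<ℓ ⟩
      d i + suc (d (suc i))    ≤⟨ ℕ.+-mono-≤ (d≤-prefix i (ℕ.<⇒≤ i<ℓ)) (s≤s (d≤-suffix (suc i) r eq)) ⟩
      i + suc r                ≡⟨ trans (ℕ.+-suc i r) eq ⟩
      ℓ                        ≡⟨ period≡size ⟩
      ∣ C ∣                    ∎
  short-candidate N even | no none with inside⊎sharing
  ... | inj₁ (i , i<ℓ , e∉T , Z⊆C) = C , (ε i , ε i , e∉T , e∉T , inj₁ (sym (inside⇒≡ e∉T Z⊆C))) , even , ℕ.≤-refl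
  ... | inj₂ p with sharing-bound p
  ... | s , r , eq-r , eq , ∣D∣≤ = D , (ε i , ε j , εi∉T , εj∉T , inj₂ (εi≢εj , shared , refl)) , D-even , bound
    where
    open SharingPair p
    D = Z (ε i) ⊕ Z (ε j)
    odd-chord : ∀ {i} → i < ℓ → ε i ∉ T → Z (ε i) ∙ N ≡ true
    odd-chord i<ℓ ε∉T = Bool.¬-not λ Z-even → none (_ , edge∈ i<ℓ , ε∉T , Z-even)
    D-even : D ∙ N ≡ false
    D-even = trans (∙-distribʳ-⊕ N (Z (ε i)) (Z (ε j))) (cong₂ _xor_ (odd-chord i<ℓ εi∉T) (odd-chord j<ℓ εj∉T))
    bound : ∣ D ∣ ≤ ∣ C ∣
    bound = begin
      ∣ D ∣                             ≤⟨ ∣D∣≤ ⟩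
      suc (d i) + (suc s + d (suc j))   ≤⟨ ℕ.+-mono-≤ (s≤s (d≤-prefix i (ℕ.<⇒≤ i<ℓ))) (ℕ.+-monoʳ-≤ (suc s) (d≤-suffix (suc j) r eq-r)) ⟩
      suc i + (suc s + r)               ≡⟨ eq ⟩
      ℓ                                 ≡⟨ period≡size ⟩
      ∣ C ∣                             ∎

  -- The two arcs and the edge make up `C`, so a fundamental cycle as long as `C` leaves no slack:
  -- both arcs are shortest paths. Distances of adjacent vertices then compare the arcs.
  Z-long⇒tight : ∀ {i r} → suc i + r ≡ ℓ → ℓ ≤ ∣ Z (ε i) ∣ → d i ≡ i × d (suc i) ≡ r × i ≤ suc r × r ≤ suc i
  Z-long⇒tight {i} {r} eq ℓ≤ =
    di , dsi ,
    subst₂ (λ p q → p ≤ suc q) di dsi (dist-lipschitz (joins-sym G (joins i<ℓ))) ,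
    subst₂ (λ p q → p ≤ suc q) dsi di (dist-lipschitz (joins i<ℓ))
    where
    i<ℓ : i < ℓ
    i<ℓ = subst (suc i ≤_) eq (ℕ.m≤m+n (suc i) r)
    tight : d i ≡ i × suc (d (suc i)) ≡ suc r
    tight = +-tight (d≤-prefix i (ℕ.<⇒≤ i<ℓ)) (s≤s (d≤-suffix (suc i) r eq))
      (subst (_≤ d i + suc (d (suc i))) (trans (sym eq) (sym (ℕ.+-suc i r))) (ℕ.≤-trans ℓ≤ (∣Z∣≤ i<ℓ)))
    di = proj₁ tight
    dsi = ℕ.suc-injective (proj₂ tight)

  -- Along an arc that is a shortest path each edge increases the distance by one.
  even-before : ∀ {h p} → h < p → p ≤ ℓ → d p ≡ p → odd ∣ Z (ε h) ∣ ≡ false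
  even-before h<p p≤ℓ eq = even-ascent (ℕ.<-≤-trans h<p p≤ℓ)
    (trans (d-tight-prefix h<p p≤ℓ eq) (cong suc (sym (d-tight-prefix (ℕ.<⇒≤ h<p) p≤ℓ eq))))

  even-after : ∀ {h p q} → p ≤ h → h < ℓ → p + q ≡ ℓ → d p ≡ q → odd ∣ Z (ε h) ∣ ≡ false
  even-after {h} p≤h h<ℓ p+q eq with ℕ.m≤n⇒∃[o]m+o≡n h<ℓ
  ... | r , h+r = even-descent h<ℓ (trans (d-tight-suffix p≤h p+q (trans (ℕ.+-suc h r) h+r) eq)
    (cong suc (sym (d-tight-suffix (ℕ.m≤n⇒m≤1+n p≤h) p+q h+r eq))))

  module _ {k} (ℓ≡k+k : ℓ ≡ k + k) (min : ∀ D → IsCycle G D → odd ∣ D ∣ ≡ false → ℓ ≤ ∣ D ∣) where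

    -- By minimality the fundamental cycle is no shorter than `C`, so both arcs to the root are
    -- shortest; as `ℓ` is even, the chord ends at the antipode `c k` of the root.
    even-chord : ∀ {i} → i < ℓ → ε i ∉ T → odd ∣ Z (ε i) ∣ ≡ false → d k ≡ k × (i ≡ k ⊎ suc i ≡ k)
    even-chord {i} i<ℓ ε∉T even =
      let r , eq = ℕ.m≤n⇒∃[o]m+o≡n i<ℓ
          di , dsi , i≤ , r≤ = Z-long⇒tight eq (min _ (Z-cycle ε∉T) even)
      in case central {k = k} (trans eq ℓ≡k+k) i≤ r≤ of λ
        { (inj₁ i≡k) → subst (λ p → d p ≡ p) i≡k di , inj₁ i≡k
        ; (inj₂ 1+i≡k) → trans (cong d (sym 1+i≡k)) (trans dsi
            (ℕ.+-cancelˡ-≡ (suc i) r k (trans eq (trans ℓ≡k+k (cong (_+ k) (sym 1+i≡k)))))) , inj₂ 1+i≡k }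

    -- Distances rise along the first half of `C` and fall along the second, so every chord has an
    -- even fundamental cycle and is one of the two edges at `c k`.
    chords-central : d k ≡ k → ∀ {g} → g ∈ C → g ∉ T → g ≡ ε (pred k) ⊎ g ≡ ε k
    chords-central dk≡k = by-index (λ g → g ∉ T → g ≡ ε (pred k) ⊎ g ≡ ε k) λ i<ℓ ε∉T →
      -- The edge arriving at `c k` has index `pred k`, the one leaving it has index `k`.
      [ (λ i≡k → inj₂ (cong ε i≡k)) , (λ 1+i≡k → inj₁ (cong (ε ∘ pred) 1+i≡k)) ]′
      (proj₂ (even-chord i<ℓ ε∉T (even i<ℓ)))
      where
      even : ∀ {i} → i < ℓ → odd ∣ Z (ε i) ∣ ≡ false
      even {i} i<ℓ with ℕ.<-≤-connex i k
      ... | inj₁ i<k = even-before i<k (subst (k ≤_) (sym ℓ≡k+k) (ℕ.m≤m+n k k)) dk≡k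
      ... | inj₂ k≤i = even-after k≤i i<ℓ (sym ℓ≡k+k) dk≡k

    module _ (dk≢k : d k ≢ k) (p : SharingPair) where
      open SharingPair p

      odd-chord : ∀ {i} → i < ℓ → ε i ∉ T → odd ∣ Z (ε i) ∣ ≡ true
      odd-chord i<ℓ ε∉T = Bool.¬-not λ even → dk≢k (proj₁ (even-chord i<ℓ ε∉T even))

      sharing-long : ℓ ≤ ∣ Z (ε i) ⊕ Z (ε j) ∣
      sharing-long = min _ (Z⊕Z-cycle εi∉T εj∉T εi≢εj shared)
        (trans (sym (∙⊤ (Z (ε i) ⊕ Z (ε j)))) (trans (∙-distribʳ-⊕ ⊤ (Z (ε i)) (Z (ε j))) (cong₂ _xor_
          (trans (∙⊤ (Z (ε i))) (odd-chord i<ℓ εi∉T)) (trans (∙⊤ (Z (ε j))) (odd-chord j<ℓ εj∉T)))))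

      -- The sum is an even cycle, so by minimality its upper bound is attained, and the arcs before
      -- `ε i` and after `ε j` are shortest paths.
      sharing-tight : ∃[ r ] (suc j + r ≡ ℓ × d i ≡ i × d (suc j) ≡ r)
      sharing-tight =
        let s , r , eq-r , eq , ∣D∣≤ = sharing-bound p
            di , dj = +-tight (s≤s (d≤-prefix i (ℕ.<⇒≤ i<ℓ))) (ℕ.+-monoʳ-≤ (suc s) (d≤-suffix (suc j) r eq-r))
              (ℕ.≤-trans (ℕ.≤-reflexive eq) (ℕ.≤-trans sharing-long ∣D∣≤))
        in r , eq-r , ℕ.suc-injective di , ℕ.+-cancelˡ-≡ (suc s) _ _ dj

      -- A chord before `ε i` or after `ε j` would lie on a shortest arc and have an even
      -- fundamental cycle; between the two there is no chord.
      chord-position : ∀ {h} → h < ℓ → ε h ∉ T → ε h ≡ ε i ⊎ ε h ≡ ε j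
      chord-position {h} h<ℓ ε∉T with ℕ.<-cmp h i | ℕ.<-cmp h j
      ... | tri≈ _ h≡i _ | _ = inj₁ (cong ε h≡i)
      ... | _ | tri≈ _ h≡j _ = inj₂ (cong ε h≡j)
      ... | tri> _ _ i<h | tri< h<j _ _ = contradiction (between i<h h<j) ε∉T
      ... | tri< h<i _ _ | _ = contradiction
            (trans (sym (odd-chord h<ℓ ε∉T)) (even-before h<i (ℕ.<⇒≤ i<ℓ) (proj₁ (proj₂ (proj₂ sharing-tight))))) λ ()
      ... | _ | tri> _ _ j<h = contradiction
            (trans (sym (odd-chord h<ℓ ε∉T)) (even-after j<h h<ℓ (proj₁ (proj₂ sharing-tight)) (proj₂ (proj₂ (proj₂ sharing-tight))))) λ ()

  shortest-even : Even ∣ C ∣ → (∀ D → IsCycle G D → odd ∣ D ∣ ≡ false → ℓ ≤ ∣ D ∣) →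
    IsFundamentalCycle G T C ⊎
    (∃[ A ] ∃[ B ] (IsFundamentalCycle G T A × IsFundamentalCycle G T B × C ≡ A ⊕ B))
  shortest-even (divides k ∣C∣≡) min with d k ℕ.≟ k | inside⊎sharing
  ... | yes dk≡k | _ = two-chords cyc λ g∉T g∈C → chords-central (trans period≡size (trans ∣C∣≡ (i*2≡i+i k))) min dk≡k g∈C g∉T
  ... | no _ | inj₁ (i , i<ℓ , e∉T , Z⊆C) =
        inj₁ (subst (IsFundamentalCycle G T) (inside⇒≡ e∉T Z⊆C) (Z-fundamental e∉T))
  ... | no dk≢k | inj₂ p = two-chords cyc λ g∉T g∈C → by-index
        (λ g → g ∉ T → g ≡ ε (SharingPair.i p) ⊎ g ≡ ε (SharingPair.j p))
        (chord-position (trans period≡size (trans ∣C∣≡ (i*2≡i+i k))) min dk≢k p) g∈C g∉T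

  -- No fundamental cycle is shorter than `C`, so at every chord the two arcs to the root differ by
  -- at most one. As `ℓ` is odd they are equal, which singles out one edge.
  odd-girth : Odd ∣ C ∣ → (∀ D → IsCycle G D → ℓ ≤ ∣ D ∣) → IsFundamentalCycle G T C
  odd-girth ∣C∣-odd min with any? (λ e → ¬? (e ∈? T) ×-dec (e ∈? C))
  ... | no none = cycle⊈T cyc (λ {g} g∈C → case g ∈? T of λ
        { (yes g∈T) → g∈T ; (no g∉T) → contradiction (g , g∉T , g∈C) none })
  ... | yes (e , e∉T , e∈C) = fundamental e∉T cyc λ {g} g∉T g∈C → by-index (λ g → g ∉ T → g ≡ e)
          (λ {i} i<ℓ εi∉T → by-index (λ e → e ∉ T → ε i ≡ e)
            (λ {j} j<ℓ εj∉T → cong ε (double-injective {i} {j} (ℕ.suc-injective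
              (trans (antipodal i<ℓ εi∉T) (sym (antipodal j<ℓ εj∉T))))))
            e∈C e∉T)
          g∈C g∉T
    where
    odd-ℓ : ∀ k → k + k ≢ ℓ
    odd-ℓ k eq = ∣C∣-odd (odd≡false⇒even ∣ C ∣ (trans (cong odd (trans (sym period≡size) (sym eq))) (odd-double k)))
    balance : ∀ {i r} → suc i + r ≡ ℓ → i ≤ suc r → r ≤ suc i → suc (i + i) ≡ ℓ
    balance {i} {r} eq i≤ r≤ with ℕ.m≤n⇒m<n∨m≡n i≤ | ℕ.m≤n⇒m<n∨m≡n r≤
    -- Arcs differing by exactly one would make `ℓ` even.
    ... | inj₂ refl | _ = contradiction (trans (cong suc (ℕ.+-suc r r)) eq) (odd-ℓ (suc r))
    ... | _ | inj₂ refl = contradiction eq (odd-ℓ (suc i))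
    ... | inj₁ (s≤s i≤r) | inj₁ (s≤s r≤i) = trans (cong (λ k → suc (i + k)) (ℕ.≤-antisym i≤r r≤i)) eq
    antipodal : ∀ {i} → i < ℓ → ε i ∉ T → suc (i + i) ≡ ℓ
    antipodal i<ℓ ε∉T =
      let r , eq = ℕ.m≤n⇒∃[o]m+o≡n i<ℓ
          _ , _ , i≤ , r≤ = Z-long⇒tight eq (min _ (Z-cycle ε∉T))
      in balance eq i≤ r≤

theoremA : ∀ {n m : ℕ} (G : Graph n m) → Connected G →
    (Π : EmbeddingScheme G) →
    (T : Fin n → Subset m) → (∀ x → IsBFSTree G x (T x)) →
    (∃ (TwoSidedCycle G Π) →
    ∃[ C ] (𝒞 G T C × IsMinimum (TwoSidedCycle G Π) C)) ×
    (∀ C → IsMinimum (EvenCycle G) C → 𝒞 G T C) ×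
    ((∃[ S ] (IsMinimum (IsCycle G) S × Odd ∣ S ∣)) →
    ∀ C → IsMinimum (OddCycle G) C → 𝒞₁ G T C)
theoremA {n} {m} G _ Π T bfs = two-sided , even , odd-girth′
  where
  Neg = EmbeddingScheme.negativeEdges Π

  module At (x : Fin n) = Candidates G (bfs x)

  -- The root varies, since each two-sided cycle is compared with a candidate of a tree rooted on
  -- that cycle.
  Short : Subset m → Set
  Short D = (∃[ x ] At.Candidate x D) × D ∙ Neg ≡ false

  short⇒twoSided : ∀ {D} → Short D → TwoSidedCycle G Π D
  short⇒twoSided ((x , cand) , even) = At.candidate-cycle x cand , odd≡false⇒even _ even

  short⇒𝒞 : ∀ {D} → Short D → 𝒞 G T D
  short⇒𝒞 ((x , e , f , e∉T , f∉T , inj₁ refl) , _) = inj₁ (x , Rooted.Z-fundamental G (bfs x) e∉T)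
  short⇒𝒞 ((x , cand@(e , f , e∉T , f∉T , inj₂ (_ , _ , refl))) , _) = inj₂ (At.candidate-cycle x cand ,
    _ , _ , (x , Rooted.Z-fundamental G (bfs x) e∉T) , (x , Rooted.Z-fundamental G (bfs x) f∉T) , refl)

  shorten : ∀ {C} → TwoSidedCycle G Π C → ∃[ D ] (Short D × ∣ D ∣ ≤ ∣ C ∣)
  shorten (cyc , even) with ShortCandidate.short-candidate G cyc (tour G cyc) (bfs _) Neg (even⇒odd≡false even)
  ... | D , cand , D-even , D≤C = D , ((_ , cand) , D-even) , D≤C

  two-sided : ∃ (TwoSidedCycle G Π) → ∃[ C ] (𝒞 G T C × IsMinimum (TwoSidedCycle G Π) C)
  two-sided (C , twoSided) with shorten twoSided
  ... | D , short , _ with minimal-subset (λ D → any? (λ x → At.candidate? x D) ×-dec (D ∙ Neg Bool.≟ false)) (D , short)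
  ... | M , short-M , min = M , short⇒𝒞 short-M , short⇒twoSided short-M ,
    λ E twoSided-E → case shorten twoSided-E of λ { (D , short-D , D≤E) → ℕ.≤-trans (min D short-D) D≤E }

  even : ∀ C → IsMinimum (EvenCycle G) C → 𝒞 G T C
  even C ((cyc , ∣C∣-even) , min) with ShortCandidate.shortest-even G cyc (tour G cyc) (bfs _) ∣C∣-even
    (λ D cyc-D D-even → subst (_≤ ∣ D ∣) (sym (Tour.period≡size (tour G cyc))) (min D (cyc-D , odd≡false⇒even _ D-even)))
  ... | inj₁ fund = inj₁ (_ , fund)
  ... | inj₂ (A , B , fund-A , fund-B , eq) = inj₂ (cyc , A , B , (_ , fund-A) , (_ , fund-B) , eq)

  odd-girth′ : (∃[ S ] (IsMinimum (IsCycle G) S × Odd ∣ S ∣)) → ∀ C → IsMinimum (OddCycle G) C → 𝒞₁ G T C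
  odd-girth′ (S , (cyc-S , S-min) , S-odd) C ((cyc , C-odd) , C-min) =
    -- The shortest cycle `S` is odd, so `C`, being shortest among odd cycles, is no longer than any
    -- cycle.
    _ , ShortCandidate.odd-girth G cyc (tour G cyc) (bfs _) C-odd λ D cyc-D →
      subst (_≤ ∣ D ∣) (sym (Tour.period≡size (tour G cyc))) (ℕ.≤-trans (C-min S (cyc-S , S-odd)) (S-min D cyc-D))
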